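{- Let $G$ be a finite graph with at least one vertex such that (i) for every two distinct nonadjacent vertices $u,v$ of $G$, there are exactly two vertices adjacent to both $u$ and $v$, and these two vertices are adjacent to each other; and (ii) $G$ has no clique of cardinality four. Then $G$ has a universal vertex, i.e. a vertex adjacent to every other vertex of $G$.
   Context: Graphs are finite and simple. (The paper calls a graph satisfying (i) and (ii) "bijoined".) -}

module Defs where

open import Data.Nat using (ℕ)
open import Data.Fin using (Fin)
open import Data.Product using (Σ; _×_; ∃-syntax)
open import Data.Sum using (_⊎_)
open import Relation.Nullary using (¬_; Dec)
open import Relation.Binary.PropositionalEquality using (_≡_; _≢_)
open import Level using (0ℓ) renaming (suc to lsuc)

record Graph (n : ℕ) : Set₁ where
  field
    Adj    : Fin n → Fin n → Set
    adj?   : ∀ u v → Dec (Adj u v)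
    irrefl : ∀ u → ¬ Adj u u
    sym    : ∀ u v → Adj u v → Adj v u

module _ {n : ℕ} (G : Graph n) where
  open Graph G

  CommonNbr : Fin n → Fin n → Fin n → Set
  CommonNbr u v w = Adj u w × Adj v w

  Condition-i : Set
  Condition-i = ∀ u v → u ≢ v → ¬ Adj u v →
    ∃[ a ] ∃[ b ] (a ≢ b × CommonNbr u v a × CommonNbr u v b × Adj a b
                   × (∀ w → CommonNbr u v w → w ≡ a ⊎ w ≡ b))

  -- a clique of cardinality four: four pairwise distinct, pairwise adjacent
  -- vertices (adjacency of distinct vertices; irreflexivity gives distinctness)
  IsK4 : Fin n → Fin n → Fin n → Fin n → Set
  IsK4 a b c d = Adj a b × Adj a c × Adj a d × Adj b c × Adj b d × Adj c d

  Condition-ii : Set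
  Condition-ii = ∀ a b c d → ¬ IsK4 a b c d

  Universal : Fin n → Set
  Universal x = ∀ y → y ≢ x → Adj x y

{-# OPTIONS --safe #-}

-- Suppose that no vertex is universal. By (i) and (ii) the graph induced on the
-- neighbours of a vertex v is triangle-free and two nonadjacent vertices of it
-- have exactly one common neighbour in it. It is not a star, as the centre of a
-- star would be universal, so it is a Moore graph of some degree k, and k does
-- not depend on v. Hence G is strongly regular with parameters (n, k² + 1, k, 2).
--
-- The trace of a matrix E with E² = cE over an integral domain of characteristic
-- zero is a natural multiple of c (a division-free form of trace = rank for
-- idempotents). Applied to the projection onto an eigenspace of a strongly
-- regular graph, over ℤ or ℤ[√D], it gives the usual integrality conditions.
-- For the Moore graph they leave k ∈ {2, 3, 7, 57}; for those k the discriminant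
-- k(5k - 4) of G is not a square, which forces (k - 2)(n - 1) + 2(k² + 1) = 0.
module Submission where

open import Defs
open import Algebra.Bundles using (CommutativeRing)
import Algebra.Properties.Semiring.Sum as SemiringSum
import Algebra.Solver.Ring as RingSolver
open import Algebra.Solver.Ring.AlmostCommutativeRing
  using (fromCommutativeRing; _-Raw-AlmostCommutative⟶_)
open import Data.Empty using (⊥)
open import Data.Fin using (Fin; toℕ; fromℕ<)
import Data.Fin as Fin
open import Data.Fin.Properties using (all?; any?; toℕ<n; toℕ-injective; toℕ-fromℕ<)
open import Data.Integer using (ℤ; +_; 0ℤ; 1ℤ)
import Data.Integer as ℤ
import Data.Integer.Properties as ℤ
import Data.Integer.Tactic.RingSolver as ℤ
import Data.Maybe as Maybe
open import Data.Nat using (ℕ; zero; suc)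
import Data.Nat as ℕ
import Data.Nat.Properties as ℕ
import Data.Nat.Tactic.RingSolver as ℕ
open import Data.Nat.Coprimality using (Coprime; coprime-divisor; coprime-/gcd)
open import Data.Nat.Divisibility using (_∣_; divides; _∣?_; ∣⇒≤; ∣-refl)
open import Data.Nat.DivMod using (m/n*n≡m)
open import Data.Nat.GCD using (gcd; gcd[m,n]∣m; gcd[m,n]∣n; gcd[m,n]≢0)
open import Data.Product using (∃; ∃-syntax; _×_; _,_; proj₁; proj₂)
open import Data.Product.Properties using (≡-dec)
open import Data.Sum using (_⊎_; inj₁; inj₂; [_,_]′)
open import Function using (_∘_)
open import Level using (0ℓ)
open import Relation.Binary.Definitions using (Decidable)
open import Relation.Binary.PropositionalEquality using (_≡_; _≢_; cong; cong₂; subst)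
import Relation.Binary.PropositionalEquality as ≡
import Relation.Binary.Reasoning.Setoid as SetoidReasoning
open import Relation.Nullary using (¬_; Dec; yes; no; contradiction)
open import Relation.Nullary.Decidable
  using (dec⇒maybe; from-yes; ¬?; decidable-stable; _→-dec_; _⊎-dec_; _×-dec_)

-- Sums of natural numbers and strongly regular graphs

-- The delicate point on the graph side is that N(v) is regular: a priori the local degree `κ v x`
-- varies with x. With L the adjacency matrix of N(v), the local conditions read L² + L + I = diag κ
-- + J. The left side commutes with L, hence so does the right, and this equates the degrees of
-- nonadjacent vertices of N(v); a path in the complement then settles adjacent ones. The degree is
-- the same for all v because `κ` is symmetric in its two arguments and (i) makes any two vertices
-- equal, adjacent or joined by a path of length two.
--
-- The spectral argument is applied both to N(v) and to G. A vertex set is therefore an indicator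
-- function on `Fin n`, which spares renumbering N(v). No eigenvector is ever formed: the projection
-- is an explicit combination of M, the identity and J, and its rank is read off its trace. Working
-- in ℤ[√D] for a nonsquare discriminant D expresses that conjugate eigenvalues have equal
-- multiplicities.

module ℕΣ = SemiringSum ℕ.+-*-semiring

𝟙 : {P : Set} → Dec P → ℕ
𝟙 (yes _) = 1
𝟙 (no _)  = 0

𝟙-yes : {P : Set} (P? : Dec P) → P → 𝟙 P? ≡ 1
𝟙-yes (yes _) _ = ≡.refl
𝟙-yes (no ¬p) p = contradiction p ¬p

𝟙-no : {P : Set} (P? : Dec P) → ¬ P → 𝟙 P? ≡ 0
𝟙-no (yes p) ¬p = contradiction p ¬p
𝟙-no (no _)  _  = ≡.refl

𝟙-cong : {P Q : Set} (P? : Dec P) (Q? : Dec Q) → (P → Q) → (Q → P) → 𝟙 P? ≡ 𝟙 Q?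
𝟙-cong (yes p) Q? f g = ≡.sym (𝟙-yes Q? (f p))
𝟙-cong (no ¬p) Q? f g = ≡.sym (𝟙-no Q? (¬p ∘ g))

𝟙-* : {P Q : Set} (P? : Dec P) (Q? : Dec Q) → 𝟙 P? ℕ.* 𝟙 Q? ≡ 𝟙 (P? ×-dec Q?)
𝟙-* (yes _) (yes _) = ≡.refl
𝟙-* (yes _) (no _)  = ≡.refl
𝟙-* (no _)  _       = ≡.refl

δ : ∀ {n} → Fin n → Fin n → ℕ
δ u v = 𝟙 (u Fin.≟ v)

module NatSums where
  open import Data.Nat using (_+_; _*_)
  open ℕΣ
  open ≡.≡-Reasoning
  open import Algebra.Properties.CommutativeSemigroup ℕ.*-commutativeSemigroup using (x∙yz≈y∙xz)

  δ-sym : ∀ {n} (u v : Fin n) → δ u v ≡ δ v u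
  δ-sym u v with u Fin.≟ v
  ... | yes u≡v = ≡.sym (𝟙-yes (v Fin.≟ u) (≡.sym u≡v))
  ... | no  u≢v = ≡.sym (𝟙-no (v Fin.≟ u) (λ v≡u → u≢v (≡.sym v≡u)))

  δ-suc : ∀ {n} (u v : Fin n) → δ (Fin.suc u) (Fin.suc v) ≡ δ u v
  δ-suc u v with u Fin.≟ v
  ... | yes _ = ≡.refl
  ... | no  _ = ≡.refl

  sum-0 : ∀ {n} (f : Fin n → ℕ) → (∀ i → f i ≡ 0) → sum f ≡ 0
  sum-0 {n} f f≡0 = ≡.trans (sum-cong-≗ f≡0) (sum-replicate-zero n)

  sum-δˡ : ∀ {n} (u : Fin n) f → sum (λ w → δ u w * f w) ≡ f u
  sum-δˡ Fin.zero f = begin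
    f Fin.zero + 0 + sum (λ w → δ Fin.zero (Fin.suc w) * f (Fin.suc w))
      ≡⟨ cong₂ _+_ (ℕ.+-identityʳ _) (sum-0 (λ w → δ Fin.zero (Fin.suc w) * f (Fin.suc w)) (λ _ → ≡.refl)) ⟩
    f Fin.zero + 0 ≡⟨ ℕ.+-identityʳ _ ⟩
    f Fin.zero ∎
  sum-δˡ (Fin.suc u) f = ≡.trans
    (sum-cong-≗ (λ w → cong (_* f (Fin.suc w)) (δ-suc u w)))
    (sum-δˡ u (λ w → f (Fin.suc w)))

  sum-δʳ : ∀ {n} (v : Fin n) f → sum (λ w → f w * δ w v) ≡ f v
  sum-δʳ v f = ≡.trans
    (sum-cong-≗ (λ w → ≡.trans (ℕ.*-comm (f w) _) (cong (_* f w) (δ-sym w v))))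
    (sum-δˡ v f)

  sum-δ : ∀ {n} (c : Fin n) → sum (λ w → δ w c) ≡ 1
  sum-δ c = ≡.trans (sum-cong-≗ (λ w → ≡.sym (ℕ.*-identityˡ (δ w c)))) (sum-δʳ c (λ _ → 1))

  sum-1 : ∀ n → sum {n} (λ _ → 1) ≡ n
  sum-1 zero    = ≡.refl
  sum-1 (suc n) = cong suc (sum-1 n)

  sum-mono-≤ : ∀ {m} {f g : Fin m → ℕ} → (∀ i → f i ℕ.≤ g i) → sum f ℕ.≤ sum g
  sum-mono-≤ {zero}  f≤g = ℕ.z≤n
  sum-mono-≤ {suc m} f≤g = ℕ.+-mono-≤ (f≤g Fin.zero) (sum-mono-≤ (λ i → f≤g (Fin.suc i)))

  -- A strongly regular graph with adjacency matrix M on the vertex set whose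
  -- indicator function is χ.
  record StronglyRegular {n : ℕ} (χ : Fin n → ℕ) (M : Fin n → Fin n → ℕ)
                         (d l μ : ℕ) : Set where
    field
      vertex     : Fin n
      χ-vertex   : χ vertex ≡ 1
      idempotent : ∀ u → χ u * χ u ≡ χ u
      loopless   : ∀ u → M u u ≡ 0
      symmetric  : ∀ u v → M u v ≡ M v u
      support    : ∀ u v → M u v * χ v ≡ M u v
      regular    : ∀ u → sum (M u) ≡ d * χ u
      -- The usual M² = d I + l M + μ (J - I - M), restricted to the vertex set, with the negative
      -- terms moved to the left because the entries are natural numbers.
      square     : ∀ u v → sum (λ w → M u w * M w v) + μ * (M u v + χ u * δ u v)
                     ≡ d * (χ u * δ u v) + l * M u v + μ * (χ u * χ v)

    Δ X : Fin n → Fin n → ℕ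
    Δ u v = χ u * δ u v
    X u v = χ u * χ v

    supportˡ : ∀ u v → χ u * M u v ≡ M u v
    supportˡ u v = ≡.trans (ℕ.*-comm (χ u) _) (≡.trans (cong (_* χ u) (symmetric u v))
      (≡.trans (support v u) (symmetric v u)))

    -- `Δ` and `X` are the identity and the all-ones matrix of the vertex set. Together with
    -- `square`, this lemma and the next ones form the multiplication table of the span of `Δ`, `M`
    -- and `X`.
    M∙Δ : ∀ u v → sum (λ w → M u w * Δ w v) ≡ M u v
    M∙Δ u v = ≡.trans (sum-cong-≗ λ w → ≡.trans (≡.sym (ℕ.*-assoc (M u w) _ _))
      (cong (_* δ w v) (support u w))) (sum-δʳ v (M u))

    Δ∙M : ∀ u v → sum (λ w → Δ u w * M w v) ≡ M u v
    Δ∙M u v = begin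
      sum (λ w → χ u * δ u w * M w v)   ≡⟨ sum-cong-≗ (λ w → ℕ.*-assoc (χ u) (δ u w) (M w v)) ⟩
      sum (λ w → χ u * (δ u w * M w v)) ≡⟨ *-distribˡ-sum (χ u) (λ w → δ u w * M w v) ⟨
      χ u * sum (λ w → δ u w * M w v)   ≡⟨ cong (χ u *_) (sum-δˡ u (λ w → M w v)) ⟩
      χ u * M u v                       ≡⟨ supportˡ u v ⟩
      M u v ∎

    M∙X : ∀ u v → sum (λ w → M u w * X w v) ≡ d * X u v
    M∙X u v = begin
      sum (λ w → M u w * (χ w * χ v)) ≡⟨ sum-cong-≗ (λ w → ≡.trans (≡.sym (ℕ.*-assoc (M u w) _ _))
                                           (cong (_* χ v) (support u w))) ⟩
      sum (λ w → M u w * χ v)         ≡⟨ *-distribʳ-sum (χ v) (M u) ⟨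
      sum (M u) * χ v                 ≡⟨ cong (_* χ v) (regular u) ⟩
      d * χ u * χ v                   ≡⟨ ℕ.*-assoc d _ _ ⟩
      d * X u v                       ∎

    X∙M : ∀ u v → sum (λ w → X u w * M w v) ≡ d * X u v
    X∙M u v = begin
      sum (λ w → χ u * χ w * M w v)  ≡⟨ sum-cong-≗ (λ w → ≡.trans (ℕ.*-assoc (χ u) _ _)
                                          (cong (χ u *_) (≡.trans (supportˡ w v) (symmetric w v)))) ⟩
      sum (λ w → χ u * M v w)        ≡⟨ *-distribˡ-sum (χ u) (M v) ⟨
      χ u * sum (M v)                ≡⟨ cong (χ u *_) (regular v) ⟩
      χ u * (d * χ v)                ≡⟨ x∙yz≈y∙xz (χ u) d (χ v) ⟩
      d * X u v                      ∎

    Δ∙Δ : ∀ u v → sum (λ w → Δ u w * Δ w v) ≡ Δ u v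
    Δ∙Δ u v = begin
      sum (λ w → χ u * δ u w * Δ w v)   ≡⟨ sum-cong-≗ (λ w → ℕ.*-assoc (χ u) (δ u w) (Δ w v)) ⟩
      sum (λ w → χ u * (δ u w * Δ w v)) ≡⟨ *-distribˡ-sum (χ u) (λ w → δ u w * Δ w v) ⟨
      χ u * sum (λ w → δ u w * Δ w v)   ≡⟨ cong (χ u *_) (sum-δˡ u (λ w → Δ w v)) ⟩
      χ u * (χ u * δ u v)               ≡⟨ ℕ.*-assoc (χ u) _ _ ⟨
      χ u * χ u * δ u v                 ≡⟨ cong (_* δ u v) (idempotent u) ⟩
      Δ u v ∎

    Δ∙X : ∀ u v → sum (λ w → Δ u w * X w v) ≡ X u v
    Δ∙X u v = begin
      sum (λ w → χ u * δ u w * X w v)   ≡⟨ sum-cong-≗ (λ w → ℕ.*-assoc (χ u) (δ u w) (X w v)) ⟩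
      sum (λ w → χ u * (δ u w * X w v)) ≡⟨ *-distribˡ-sum (χ u) (λ w → δ u w * X w v) ⟨
      χ u * sum (λ w → δ u w * X w v)   ≡⟨ cong (χ u *_) (sum-δˡ u (λ w → X w v)) ⟩
      χ u * (χ u * χ v)                 ≡⟨ ℕ.*-assoc (χ u) _ _ ⟨
      χ u * χ u * χ v                   ≡⟨ cong (_* χ v) (idempotent u) ⟩
      X u v ∎

    X∙Δ : ∀ u v → sum (λ w → X u w * Δ w v) ≡ X u v
    X∙Δ u v = begin
      sum (λ w → X u w * (χ w * δ w v)) ≡⟨ sum-cong-≗ (λ w → ≡.sym (ℕ.*-assoc (X u w) _ _)) ⟩
      sum (λ w → X u w * χ w * δ w v)   ≡⟨ sum-δʳ v (λ w → X u w * χ w) ⟩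
      χ u * χ v * χ v                   ≡⟨ ℕ.*-assoc (χ u) _ _ ⟩
      χ u * (χ v * χ v)                 ≡⟨ cong (χ u *_) (idempotent v) ⟩
      X u v                             ∎

    X∙X : ∀ u v → sum (λ w → X u w * X w v) ≡ sum χ * X u v
    X∙X u v = begin
      sum (λ w → χ u * χ w * (χ w * χ v)) ≡⟨ sum-cong-≗ (λ w → ≡.trans (regroup (χ u) (χ w) (χ v))
                                               (cong (_* X u v) (idempotent w))) ⟩
      sum (λ w → χ w * X u v)             ≡⟨ *-distribʳ-sum (X u v) χ ⟨
      sum χ * X u v                       ∎
      where
      regroup : ∀ a b c → a * b * (b * c) ≡ b * b * (a * c)
      regroup = ℕ.solve-∀

    -- Sum row `vertex` of `square`: both sides count the walks of length two that start there.
    count : d * d + μ * suc d ≡ d + l * d + μ * sum χ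
    count = begin
      d * d + μ * suc d
        ≡⟨ cong₂ (λ x y → x + μ * y) (≡.sym ΣMM) (≡.sym (≡.trans (cong₂ _+_ ΣM ΣΔ) (ℕ.+-comm d 1))) ⟩
      sum (λ v → sum (λ w → M o w * M w v)) + μ * (sum (M o) + sum (Δ o))
        ≡⟨ cong₂ _+_ ≡.refl (cong (μ *_) (≡.sym (∑-distrib-+ (M o) (Δ o)))) ⟩
      sum (λ v → sum (λ w → M o w * M w v)) + μ * sum (λ v → M o v + Δ o v)
        ≡⟨ cong₂ _+_ ≡.refl (*-distribˡ-sum μ (λ v → M o v + Δ o v)) ⟩
      sum (λ v → sum (λ w → M o w * M w v)) + sum (λ v → μ * (M o v + Δ o v))
        ≡⟨ ∑-distrib-+ _ (λ v → μ * (M o v + Δ o v)) ⟨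
      sum (λ v → sum (λ w → M o w * M w v) + μ * (M o v + Δ o v))
        ≡⟨ sum-cong-≗ (square o) ⟩
      sum (λ v → d * Δ o v + l * M o v + μ * X o v)
        ≡⟨ ∑-distrib-+ (λ v → d * Δ o v + l * M o v) (λ v → μ * X o v) ⟩
      sum (λ v → d * Δ o v + l * M o v) + sum (λ v → μ * X o v)
        ≡⟨ cong₂ _+_ (∑-distrib-+ (λ v → d * Δ o v) (λ v → l * M o v)) ≡.refl ⟩
      sum (λ v → d * Δ o v) + sum (λ v → l * M o v) + sum (λ v → μ * X o v)
        ≡⟨ cong₂ _+_ (cong₂ _+_ (*-distribˡ-sum d (Δ o)) (*-distribˡ-sum l (M o))) (*-distribˡ-sum μ (X o)) ⟨
      d * sum (Δ o) + l * sum (M o) + μ * sum (X o)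
        ≡⟨ cong₂ _+_ (cong₂ _+_ (≡.trans (cong (d *_) ΣΔ) (ℕ.*-identityʳ d)) (cong (l *_) ΣM))
                     (cong (μ *_) ΣX) ⟩
      d + l * d + μ * sum χ ∎
      where
      o = vertex
      ΣM : sum (M o) ≡ d
      ΣM = ≡.trans (regular o) (≡.trans (cong (d *_) χ-vertex) (ℕ.*-identityʳ d))
      ΣX : sum (X o) ≡ sum χ
      ΣX = sum-cong-≗ (λ v → ≡.trans (cong (_* χ v) χ-vertex) (ℕ.*-identityˡ (χ v)))
      ΣΔ : sum (Δ o) ≡ 1
      ΣΔ = begin
        sum (λ v → χ o * δ o v) ≡⟨ sum-cong-≗ (λ v → ℕ.*-comm (χ o) (δ o v)) ⟩
        sum (λ v → δ o v * χ o) ≡⟨ sum-δˡ o (λ _ → χ o) ⟩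
        χ o                     ≡⟨ χ-vertex ⟩
        1                       ∎
      ΣMM : sum (λ v → sum (λ w → M o w * M w v)) ≡ d * d
      ΣMM = begin
        sum (λ v → sum (λ w → M o w * M w v)) ≡⟨ ∑-comm (λ v w → M o w * M w v) ⟩
        sum (λ w → sum (λ v → M o w * M w v)) ≡⟨ sum-cong-≗ (λ w → *-distribˡ-sum (M o w) (M w)) ⟨
        sum (λ w → M o w * sum (M w))         ≡⟨ sum-cong-≗ (λ w → ≡.trans (cong (M o w *_) (regular w)) (x∙yz≈y∙xz (M o w) d (χ w))) ⟩
        sum (λ w → d * (M o w * χ w))         ≡⟨ *-distribˡ-sum d (λ w → M o w * χ w) ⟨
        d * sum (λ w → M o w * χ w)           ≡⟨ cong (d *_) (≡.trans (sum-cong-≗ (support o)) ΣM) ⟩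
        d * d                                 ∎

open NatSums

-- Traces over integral domains

-- `morphism` embeds the integers, both as solver coefficients and as matrix entries;
-- `⟦⟧-injective₀` is characteristic zero. The decidable `_≟_` serves the search for pivots.
record Domain : Set₁ where
  field
    commutativeRing : CommutativeRing 0ℓ 0ℓ
  open CommutativeRing commutativeRing public
  field
    morphism  : ℤ.+-*-rawRing -Raw-AlmostCommutative⟶ fromCommutativeRing commutativeRing
    _≟_       : Decidable _≈_
    *-cancel₀ : ∀ x y → x * y ≈ 0# → ¬ x ≈ 0# → y ≈ 0#
  open _-Raw-AlmostCommutative⟶_ morphism public
  field
    ⟦⟧-injective₀ : ∀ z → ⟦ z ⟧ ≈ 0# → z ≡ 0ℤ

module DomainMatrices (𝔻 : Domain) where
  open Domain 𝔻
  open SemiringSum semiring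
  open RingSolver ℤ.+-*-rawRing (fromCommutativeRing commutativeRing) morphism
    (λ x y → Maybe.map (λ e → reflexive (cong ⟦_⟧ e)) (dec⇒maybe (x ℤ.≟ y)))
    using (solve; con; _:=_; _:+_; _:*_; :-_; _:-_)
  open SetoidReasoning setoid

  Matrix : ℕ → Set
  Matrix n = Fin n → Fin n → Carrier

  trace : ∀ {n} → Matrix n → Carrier
  trace E = sum (λ i → E i i)

  sum-linear : ∀ {n} a (f g : Fin n → Carrier) →
    sum (λ i → a * f i + g i) ≈ a * sum f + sum g
  sum-linear a f g = trans (∑-distrib-+ (λ i → a * f i) g)
    (+-congʳ (sym (*-distribˡ-sum a f)))

  -- Wedderburn's rank reduction, without division: it clears row i and
  -- keeps the zero rows of E.
  eliminate : ∀ {n} → Fin n → Fin n → Matrix n → Matrix n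
  eliminate i j E k l = E i j * E k l + (- E k j) * E i l

  -- Since E² = cE, column j is scaled by c under left multiplication with E, row i likewise under
  -- right multiplication, and row i times column j is c times the pivot. Each of the four products
  -- in the expansion thus yields one factor c.
  eliminate-square : ∀ {n} i j (E : Matrix n) c →
    (∀ k l → sum (λ m → E k m * E m l) ≈ c * E k l) →
    ∀ k l → sum (λ m → eliminate i j E k m * eliminate i j E m l)
      ≈ (c * E i j) * eliminate i j E k l
  eliminate-square i j E c E² k l = begin
    sum (λ m → eliminate i j E k m * eliminate i j E m l)
      ≈⟨ sum-cong-≋ (λ m → expand (E k m) (E m l) (E m j) (E i m)) ⟩
    sum (λ m → a₁ * f₁ m + (a₂ * f₂ m + (a₃ * f₃ m + a₄ * f₄ m)))
      ≈⟨ trans (sum-linear a₁ f₁ _) (+-congˡ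
           (trans (sum-linear a₂ f₂ _) (+-congˡ
           (trans (sum-linear a₃ f₃ _) (+-congˡ (sym (*-distribˡ-sum a₄ f₄))))))) ⟩
    a₁ * sum f₁ + (a₂ * sum f₂ + (a₃ * sum f₃ + a₄ * sum f₄))
      ≈⟨ +-cong (*-congˡ (E² k l)) (+-cong (*-congˡ (E² k j))
           (+-cong (*-congˡ (E² i l)) (*-congˡ (E² i j)))) ⟩
    a₁ * (c * E k l) + (a₂ * (c * E k j) + (a₃ * (c * E i l) + a₄ * (c * e)))
      ≈⟨ solve 5 (λ e kl kj il c →
           (e :* e) :* (c :* kl) :+ (:- (e :* il) :* (c :* kj) :+
           (:- (e :* kj) :* (c :* il) :+ (kj :* il) :* (c :* e)))
           := (c :* e) :* (e :* kl :+ :- kj :* il)) refl e (E k l) (E k j) (E i l) c ⟩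
    (c * e) * eliminate i j E k l ∎
    where
    e = E i j
    a₁ = e * e
    a₂ = - (e * E i l)
    a₃ = - (e * E k j)
    a₄ = E k j * E i l
    f₁ = λ m → E k m * E m l
    f₂ = λ m → E k m * E m j
    f₃ = λ m → E i m * E m l
    f₄ = λ m → E i m * E m j
    expand : ∀ km ml mj im →
      (e * km + - E k j * im) * (e * ml + - mj * E i l)
      ≈ a₁ * (km * ml) + (a₂ * (km * mj) + (a₃ * (im * ml) + a₄ * (im * mj)))
    expand km ml mj im = trans
      (solve 4 (λ p q r t → (p :+ q) :* (r :+ t) := p :* r :+ (p :* t :+ (q :* r :+ q :* t)))
        refl (e * km) (- E k j * im) (e * ml) (- mj * E i l))
      (+-cong (solve 3 (λ e x y → (e :* x) :* (e :* y) := (e :* e) :* (x :* y)) refl e km ml)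
      (+-cong (solve 4 (λ e x y z → (e :* x) :* (:- y :* z) := :- (e :* z) :* (x :* y)) refl e km mj (E i l))
      (+-cong (solve 4 (λ e x y z → (:- x :* y) :* (e :* z) := :- (e :* x) :* (y :* z)) refl e (E k j) im ml)
              (solve 4 (λ x y z w → (:- x :* y) :* (:- z :* w) := (x :* w) :* (y :* z)) refl (E k j) im mj (E i l)))))

  -- The subtracted matrix, column j times row i, has the (i, j) entry of E² as its trace, which is
  -- c times the pivot.
  eliminate-trace : ∀ {n} i j (E : Matrix n) c →
    (∀ k l → sum (λ m → E k m * E m l) ≈ c * E k l) →
    trace (eliminate i j E) ≈ E i j * (trace E - c)
  eliminate-trace i j E c E² = begin
    sum (λ k → e * E k k + - E k j * E i k)
      ≈⟨ sum-cong-≋ (λ k → +-congˡ (solve 2 (λ x y → :- x :* y := con (ℤ.- 1ℤ) :* (y :* x)) refl (E k j) (E i k))) ⟩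
    sum (λ k → e * E k k + ⟦ ℤ.- 1ℤ ⟧ * (E i k * E k j))
      ≈⟨ trans (sum-linear e (λ k → E k k) _) (+-congˡ (sym (*-distribˡ-sum ⟦ ℤ.- 1ℤ ⟧ (λ k → E i k * E k j)))) ⟩
    e * trace E + ⟦ ℤ.- 1ℤ ⟧ * sum (λ k → E i k * E k j)
      ≈⟨ +-congˡ (*-congˡ (E² i j)) ⟩
    e * trace E + ⟦ ℤ.- 1ℤ ⟧ * (c * e)
      ≈⟨ solve 3 (λ e t c → e :* t :+ con (ℤ.- 1ℤ) :* (c :* e) := e :* (t :- c)) refl e (trace E) c ⟩
    e * (trace E - c) ∎
    where e = E i j

  *-cancelˡ : ∀ x y z → ¬ x ≈ 0# → x * y ≈ x * z → y ≈ z
  *-cancelˡ x y z x≉0 xy≈xz = begin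
    y            ≈⟨ solve 2 (λ y z → y := (y :- z) :+ z) refl y z ⟩
    (y - z) + z  ≈⟨ +-congʳ (*-cancel₀ x (y - z) x[y-z]≈0 x≉0) ⟩
    0# + z       ≈⟨ +-identityˡ z ⟩
    z            ∎
    where
    x[y-z]≈0 : x * (y - z) ≈ 0#
    x[y-z]≈0 = begin
      x * (y - z)    ≈⟨ solve 3 (λ x y z → x :* (y :- z) := x :* y :- x :* z) refl x y z ⟩
      x * y - x * z  ≈⟨ +-congʳ xy≈xz ⟩
      x * z - x * z  ≈⟨ -‿inverseʳ _ ⟩
      0#             ∎

  -- One elimination lowers the multiple by exactly one. The pivot, by which everything has been
  -- scaled, can be cancelled in a domain.
  eliminate-trace-multiple : ∀ {n} i j (E : Matrix n) c m → ¬ E i j ≈ 0# →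
    (∀ k l → sum (λ m → E k m * E m l) ≈ c * E k l) →
    trace (eliminate i j E) ≈ ⟦ + m ⟧ * (c * E i j) → trace E ≈ ⟦ + suc m ⟧ * c
  eliminate-trace-multiple i j E c m e≉0 E² tr =
    *-cancelˡ e (trace E) (⟦ + suc m ⟧ * c) e≉0 (begin
      e * trace E
        ≈⟨ solve 3 (λ e t c → e :* t := e :* (t :- c) :+ e :* c) refl e (trace E) c ⟩
      e * (trace E - c) + e * c
        ≈⟨ +-congʳ (eliminate-trace i j E c E²) ⟨
      trace (eliminate i j E) + e * c
        ≈⟨ +-congʳ tr ⟩
      ⟦ + m ⟧ * (c * e) + e * c
        ≈⟨ solve 3 (λ e m c → m :* (c :* e) :+ e :* c := e :* ((con 1ℤ :+ m) :* c)) refl e ⟦ + m ⟧ c ⟩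
      e * ((⟦ 1ℤ ⟧ + ⟦ + m ⟧) * c)
        ≈⟨ *-congˡ (*-congʳ (+-homo 1ℤ (+ m))) ⟨
      e * (⟦ + suc m ⟧ * c) ∎)
    where e = E i j

  eliminate-zero-row : ∀ {n} i j (E : Matrix n) k → (∀ l → E k l ≈ 0#) →
    ∀ l → eliminate i j E k l ≈ 0#
  eliminate-zero-row i j E k Eₖ≈0 l = begin
    E i j * E k l + - E k j * E i l
      ≈⟨ +-cong (*-congˡ (trans (Eₖ≈0 l) (sym 0-homo)))
                (*-congʳ (-‿cong (trans (Eₖ≈0 j) (sym 0-homo)))) ⟩
    E i j * ⟦ 0ℤ ⟧ + - ⟦ 0ℤ ⟧ * E i l
      ≈⟨ solve 2 (λ x y → x :* con 0ℤ :+ :- con 0ℤ :* y := con 0ℤ) refl (E i j) (E i l) ⟩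
    ⟦ 0ℤ ⟧ ≈⟨ 0-homo ⟩
    0#     ∎

  eliminate-pivot-row : ∀ {n} i j (E : Matrix n) l → eliminate i j E i l ≈ 0#
  eliminate-pivot-row i j E l = trans
    (solve 2 (λ x y → x :* y :+ :- x :* y := con 0ℤ) refl (E i j) (E i l)) 0-homo

  -- The multiple is the number of pivots, that is, the rank. Rows are cleared from the last to the
  -- first; each pivot is absorbed into the scale factor, so the induction must let both E and c
  -- vary.
  trace-multiple : ∀ {n} (E : Matrix n) c →
    (∀ k l → sum (λ m → E k m * E m l) ≈ c * E k l) →
    ∃[ m ] trace E ≈ ⟦ + m ⟧ * c
  trace-multiple {n} E c E² =
    reduce n E c E² (λ k n≤k → contradiction n≤k (ℕ.<⇒≱ (toℕ<n k)))
    where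
    ZeroRowsFrom : ℕ → Matrix n → Set
    ZeroRowsFrom r E = ∀ k → r ℕ.≤ toℕ k → ∀ l → E k l ≈ 0#

    extend : ∀ {r} {E : Matrix n} (r<n : r ℕ.< n) → ZeroRowsFrom (suc r) E →
      (∀ l → E (fromℕ< r<n) l ≈ 0#) → ZeroRowsFrom r E
    extend {E = E} r<n rows row k r≤k with ℕ.m≤n⇒m<n∨m≡n r≤k
    ... | inj₁ r<k = rows k r<k
    ... | inj₂ r≡k = subst (λ i → ∀ l → E i l ≈ 0#)
      (toℕ-injective (≡.trans (toℕ-fromℕ< r<n) r≡k)) row

    reduce : ∀ r (E : Matrix n) c →
      (∀ k l → sum (λ m → E k m * E m l) ≈ c * E k l) →
      ZeroRowsFrom r E → ∃[ m ] trace E ≈ ⟦ + m ⟧ * c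
    reduce-row : ∀ r (r<n : r ℕ.< n) (E : Matrix n) c →
      (∀ k l → sum (λ m → E k m * E m l) ≈ c * E k l) →
      ZeroRowsFrom (suc r) E → Dec (∃[ j ] ¬ E (fromℕ< r<n) j ≈ 0#) →
      ∃[ m ] trace E ≈ ⟦ + m ⟧ * c

    reduce zero E c E² rows = 0 , (begin
      trace E            ≈⟨ sum-cong-≋ (λ k → rows k ℕ.z≤n k) ⟩
      sum {n} (λ _ → 0#) ≈⟨ sum-replicate-zero n ⟩
      0#                 ≈⟨ zeroˡ c ⟨
      0# * c             ≈⟨ *-congʳ 0-homo ⟨
      ⟦ 0ℤ ⟧ * c         ∎)
    reduce (suc r) E c E² rows with r ℕ.<? n
    ... | no r≮n = reduce r E c E² λ k r≤k →
      contradiction (ℕ.≤-<-trans r≤k (toℕ<n k)) r≮n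
    ... | yes r<n = reduce-row r r<n E c E² rows
      (any? (λ j → ¬? (E (fromℕ< r<n) j ≟ 0#)))

    reduce-row r r<n E c E² rows (no ∄j) = reduce r E c E²
      (extend r<n rows (λ l → decidable-stable (_ ≟ 0#) (λ e≉0 → ∄j (l , e≉0))))
    reduce-row r r<n E c E² rows (yes (j , e≉0)) =
      let i = fromℕ< r<n
          m , tr = reduce r (eliminate i j E) (c * E i j) (eliminate-square i j E c E²)
            (extend r<n
              (λ k r<k → eliminate-zero-row i j E k (rows k r<k))
              (eliminate-pivot-row i j E))
      in suc m , eliminate-trace-multiple i j E c m e≉0 E² tr

  -- Eigenspace projections of strongly regular graphs

  ι : ℕ → Carrier
  ι m = ⟦ + m ⟧

  ι-+ : ∀ a b → ι (a ℕ.+ b) ≈ ι a + ι b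
  ι-+ a b = +-homo (+ a) (+ b)

  ι-* : ∀ a b → ι (a ℕ.* b) ≈ ι a * ι b
  ι-* a b = trans (reflexive (cong ⟦_⟧ (ℤ.pos-* a b))) (*-homo (+ a) (+ b))

  ι-sum : ∀ {n} (f : Fin n → ℕ) → ι (ℕΣ.sum f) ≈ sum (λ i → ι (f i))
  ι-sum {zero}  f = 0-homo
  ι-sum {suc n} f = trans (ι-+ (f Fin.zero) _) (+-congˡ (ι-sum (λ i → f (Fin.suc i))))

  ι-product : ∀ {n} (f g : Fin n → ℕ) {m} → ℕΣ.sum (λ i → f i ℕ.* g i) ≡ m →
    sum (λ i → ι (f i) * ι (g i)) ≈ ι m
  ι-product f g {m} eq = begin
    sum (λ i → ι (f i) * ι (g i))     ≈⟨ sum-cong-≋ (λ i → ι-* (f i) (g i)) ⟨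
    sum (λ i → ι (f i ℕ.* g i))       ≈⟨ ι-sum (λ i → f i ℕ.* g i) ⟨
    ι (ℕΣ.sum (λ i → f i ℕ.* g i))    ≡⟨ cong ι eq ⟩
    ι m                               ∎

  sum-linear₃ : ∀ {n} a b c (f g h : Fin n → Carrier) →
    sum (λ i → a * f i + (b * g i + c * h i)) ≈ a * sum f + (b * sum g + c * sum h)
  sum-linear₃ a b c f g h = trans (sum-linear a f _)
    (+-congˡ (trans (sum-linear b g _) (+-congˡ (sym (*-distribˡ-sum c h)))))

  module _ {n : ℕ} {χ : Fin n → ℕ} {M : Fin n → Fin n → ℕ} {d l μ : ℕ}
           (G : StronglyRegular χ M d l μ) (ρ : ℕ) (size : ℕΣ.sum χ ≡ suc ρ)
           (s : Carrier) where
    open StronglyRegular G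
      using (Δ; X; M∙Δ; Δ∙M; M∙X; X∙M; Δ∙Δ; Δ∙X; X∙Δ; X∙X; square; count; loopless; idempotent)

    -- On vectors of sum zero supported on the vertex set, M² = βM + α, with roots (β + s)/2 and
    -- τ/2. The combination `a` M + `b` Δ = 2σ (M - (τ/2) Δ) kills the eigenvectors for τ/2, and the
    -- term `c` X makes `P` kill the all-ones vector, whose eigenvalue is d. On the remaining
    -- eigenspace `P` acts as 2σ ((β + s)/2 - τ/2) = 2σs.
    β α σ τ a b c : Carrier
    β = ι l - ι μ
    α = ι d - ι μ
    σ = ι (suc ρ)
    τ = β - s
    a = ⟦ + 2 ⟧ * σ
    b = - (σ * τ)
    c = - (⟦ + 2 ⟧ * ι d - τ)

    -- A multiple of the projection onto the eigenspace of M for (β + s) / 2.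
    P : Matrix n
    P u v = a * ι (M u v) + (b * ι (Δ u v) + c * ι (X u v))

    M∙M : ∀ u v → sum (λ w → ι (M u w) * ι (M w v))
      ≈ α * ι (Δ u v) + (β * ι (M u v) + ι μ * ι (X u v))
    M∙M u v = begin
      S
        ≈⟨ solve 4 (λ S μ m δ → S := (S :+ μ :* (m :+ δ)) :- μ :* (m :+ δ)) refl S (ι μ) m′ δ′ ⟩
      (S + ι μ * (m′ + δ′)) - ι μ * (m′ + δ′)
        ≈⟨ +-congʳ squareι ⟩
      (ι d * δ′ + ι l * m′ + ι μ * x′) - ι μ * (m′ + δ′)
        ≈⟨ solve 6 (λ d l μ m δ x → (d :* δ :+ l :* m :+ μ :* x) :- μ :* (m :+ δ)
             := (d :- μ) :* δ :+ ((l :- μ) :* m :+ μ :* x)) refl (ι d) (ι l) (ι μ) m′ δ′ x′ ⟩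
      α * δ′ + (β * m′ + ι μ * x′) ∎
      where
      S  = sum (λ w → ι (M u w) * ι (M w v))
      m′ = ι (M u v)
      δ′ = ι (Δ u v)
      x′ = ι (X u v)
      squareι : S + ι μ * (m′ + δ′) ≈ ι d * δ′ + ι l * m′ + ι μ * x′
      squareι = begin
        S + ι μ * (m′ + δ′)
          ≈⟨ +-cong (sym (ι-product (M u) (λ w → M w v) ≡.refl))
                    (trans (ι-* μ _) (*-congˡ (ι-+ (M u v) (Δ u v)))) ⟨
        ι (ℕΣ.sum (λ w → M u w ℕ.* M w v)) + ι (μ ℕ.* (M u v ℕ.+ Δ u v))
          ≈⟨ ι-+ _ _ ⟨
        ι (ℕΣ.sum (λ w → M u w ℕ.* M w v) ℕ.+ μ ℕ.* (M u v ℕ.+ Δ u v))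
          ≡⟨ cong ι (square u v) ⟩
        ι (d ℕ.* Δ u v ℕ.+ l ℕ.* M u v ℕ.+ μ ℕ.* X u v)
          ≈⟨ trans (ι-+ _ _) (+-cong (trans (ι-+ _ _)
               (+-cong (ι-* d (Δ u v)) (ι-* l (M u v)))) (ι-* μ (X u v))) ⟩
        ι d * δ′ + ι l * m′ + ι μ * x′ ∎

    countι : ι d * ι d + ι μ * (⟦ 1ℤ ⟧ + ι d) ≈ ι d + ι l * ι d + ι μ * σ
    countι = begin
      ι d * ι d + ι μ * (⟦ 1ℤ ⟧ + ι d)
        ≈⟨ trans (ι-+ _ _) (+-cong (ι-* d d) (trans (ι-* μ (suc d)) (*-congˡ (ι-+ 1 d)))) ⟨
      ι (d ℕ.* d ℕ.+ μ ℕ.* suc d)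
        ≡⟨ cong ι (≡.trans count (cong (λ x → d ℕ.+ l ℕ.* d ℕ.+ μ ℕ.* x) size)) ⟩
      ι (d ℕ.+ l ℕ.* d ℕ.+ μ ℕ.* suc ρ)
        ≈⟨ trans (ι-+ _ _) (+-cong (trans (ι-+ _ _) (+-congˡ (ι-* l d))) (ι-* μ (suc ρ))) ⟩
      ι d + ι l * ι d + ι μ * σ ∎

    P-column : ∀ v (f : Fin n → ℕ) {p q r} →
      sum (λ w → ι (f w) * ι (M w v)) ≈ p →
      sum (λ w → ι (f w) * ι (Δ w v)) ≈ q →
      sum (λ w → ι (f w) * ι (X w v)) ≈ r →
      sum (λ w → ι (f w) * P w v) ≈ a * p + (b * q + c * r)
    P-column v f {p} {q} {r} eM eΔ eX = begin
      sum (λ w → ι (f w) * P w v)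
        ≈⟨ sum-cong-≋ (λ w → expand (ι (f w)) (ι (M w v)) (ι (Δ w v)) (ι (X w v))) ⟩
      sum (λ w → a * (ι (f w) * ι (M w v)) + (b * (ι (f w) * ι (Δ w v)) + c * (ι (f w) * ι (X w v))))
        ≈⟨ sum-linear₃ a b c (λ w → ι (f w) * ι (M w v)) (λ w → ι (f w) * ι (Δ w v)) (λ w → ι (f w) * ι (X w v)) ⟩
      a * sum (λ w → ι (f w) * ι (M w v)) + (b * sum (λ w → ι (f w) * ι (Δ w v)) + c * sum (λ w → ι (f w) * ι (X w v)))
        ≈⟨ +-cong (*-congˡ eM) (+-cong (*-congˡ eΔ) (*-congˡ eX)) ⟩
      a * p + (b * q + c * r) ∎
      where
      expand : ∀ f m δ x → f * (a * m + (b * δ + c * x)) ≈ a * (f * m) + (b * (f * δ) + c * (f * x))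
      expand f m δ x = trans (distribˡ f _ _) (+-cong (swap f a m)
        (trans (distribˡ f _ _) (+-cong (swap f b δ) (swap f c x))))
        where
        swap : ∀ x y z → x * (y * z) ≈ y * (x * z)
        swap = solve 3 (λ x y z → x :* (y :* z) := y :* (x :* z)) refl

    P∙P : ∀ u v → sum (λ w → P u w * P w v) ≈
      a * (a * (α * ι (Δ u v) + (β * ι (M u v) + ι μ * ι (X u v))) + (b * ι (M u v) + c * (ι d * ι (X u v))))
      + (b * (a * ι (M u v) + (b * ι (Δ u v) + c * ι (X u v)))
      + c * (a * (ι d * ι (X u v)) + (b * ι (X u v) + c * (σ * ι (X u v)))))
    P∙P u v = begin
      sum (λ w → P u w * P w v)
        ≈⟨ sum-cong-≋ (λ w → expand (ι (M u w)) (ι (Δ u w)) (ι (X u w)) (P w v)) ⟩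
      sum (λ w → a * (ι (M u w) * P w v) + (b * (ι (Δ u w) * P w v) + c * (ι (X u w) * P w v)))
        ≈⟨ sum-linear₃ a b c (λ w → ι (M u w) * P w v) (λ w → ι (Δ u w) * P w v) (λ w → ι (X u w) * P w v) ⟩
      a * sum (λ w → ι (M u w) * P w v) + (b * sum (λ w → ι (Δ u w) * P w v) + c * sum (λ w → ι (X u w) * P w v))
        ≈⟨ +-cong
             (*-congˡ (P-column v (M u) (M∙M u v)
               (ι-product (M u) (λ w → Δ w v) (M∙Δ u v))
               (trans (ι-product (M u) (λ w → X w v) (M∙X u v)) (ι-* d (X u v)))))
             (+-cong
             (*-congˡ (P-column v (Δ u)
               (ι-product (Δ u) (λ w → M w v) (Δ∙M u v))
               (ι-product (Δ u) (λ w → Δ w v) (Δ∙Δ u v))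
               (ι-product (Δ u) (λ w → X w v) (Δ∙X u v))))
             (*-congˡ (P-column v (X u)
               (trans (ι-product (X u) (λ w → M w v) (X∙M u v)) (ι-* d (X u v)))
               (ι-product (X u) (λ w → Δ w v) (X∙Δ u v))
               (trans (ι-product (X u) (λ w → X w v) (X∙X u v))
                 (trans (ι-* (ℕΣ.sum χ) (X u v)) (*-congʳ (reflexive (cong ι size)))))))) ⟩
      _ ∎
      where
      expand : ∀ m δ x p → (a * m + (b * δ + c * x)) * p ≈ a * (m * p) + (b * (δ * p) + c * (x * p))
      expand m δ x p = trans (distribʳ p _ _) (+-cong (*-assoc a m p)
        (trans (distribʳ p _ _) (+-cong (*-assoc b δ p) (*-assoc c x p))))

    module _ (discriminant : s * s ≈ β * β + ⟦ + 4 ⟧ * α) where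

      Δ-coefficient : a * a * α + b * b ≈ ⟦ + 2 ⟧ * σ * s * b
      Δ-coefficient = begin
        a * a * α + b * b
          ≈⟨ solve 4 (λ σ β α s → let τ = β :- s; a = con (+ 2) :* σ; b = :- (σ :* τ) in
               a :* a :* α :+ b :* b
               := con (+ 2) :* σ :* s :* b :+ σ :* σ :* ((β :* β :+ con (+ 4) :* α) :- s :* s)) refl σ β α s ⟩
        ⟦ + 2 ⟧ * σ * s * b + σ * σ * ((β * β + ⟦ + 4 ⟧ * α) - s * s)
          ≈⟨ +-congˡ (*-congˡ (trans (+-congʳ (sym discriminant)) (-‿inverseʳ (s * s)))) ⟩
        ⟦ + 2 ⟧ * σ * s * b + σ * σ * 0#
          ≈⟨ trans (+-congˡ (zeroʳ _)) (+-identityʳ _) ⟩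
        ⟦ + 2 ⟧ * σ * s * b ∎

      -- The two sides differ by multiples of two quantities that vanish: s² minus the discriminant,
      -- and the defect in `count`. The latter enters because `P` kills the all-ones vector only if
      -- σ is the number of vertices that the parameters dictate.
      X-coefficient : a * a * ι μ + ⟦ + 2 ⟧ * (a * c * ι d) + ⟦ + 2 ⟧ * (b * c) + c * c * σ
        ≈ ⟦ + 2 ⟧ * σ * s * c
      X-coefficient = begin
        a * a * ι μ + ⟦ + 2 ⟧ * (a * c * ι d) + ⟦ + 2 ⟧ * (b * c) + c * c * σ
          ≈⟨ solve 5 (λ σ β μ d s → let τ = β :- s; a = con (+ 2) :* σ; b = :- (σ :* τ)
                                        c = :- (con (+ 2) :* d :- τ) in
               a :* a :* μ :+ con (+ 2) :* (a :* c :* d) :+ con (+ 2) :* (b :* c) :+ c :* c :* σ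
               := con (+ 2) :* σ :* s :* c :+ σ :* ((s :* s :- (β :* β :+ con (+ 4) :* (d :- μ)))
                  :+ con (+ 4) :* (μ :* σ :- (d :* d :- d :* β :- d :+ μ)))) refl σ β (ι μ) (ι d) s ⟩
        ⟦ + 2 ⟧ * σ * s * c + σ * ((s * s - (β * β + ⟦ + 4 ⟧ * α))
          + ⟦ + 4 ⟧ * (ι μ * σ - (ι d * ι d - ι d * β - ι d + ι μ)))
          ≈⟨ +-congˡ (*-congˡ (+-cong (trans (+-congʳ discriminant) (-‿inverseʳ _)) (*-congˡ count₀))) ⟩
        ⟦ + 2 ⟧ * σ * s * c + σ * (0# + ⟦ + 4 ⟧ * 0#)
          ≈⟨ trans (+-congˡ (trans (*-congˡ (trans (+-congˡ (zeroʳ _)) (+-identityʳ _))) (zeroʳ _))) (+-identityʳ _) ⟩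
        ⟦ + 2 ⟧ * σ * s * c ∎
        where
        count₀ : ι μ * σ - (ι d * ι d - ι d * β - ι d + ι μ) ≈ 0#
        count₀ = begin
          ι μ * σ - (ι d * ι d - ι d * β - ι d + ι μ)
            ≈⟨ solve 4 (λ σ l μ d → μ :* σ :- (d :* d :- d :* (l :- μ) :- d :+ μ)
                 := (d :+ l :* d :+ μ :* σ) :- (d :* d :+ μ :* (con 1ℤ :+ d))) refl σ (ι l) (ι μ) (ι d) ⟩
          (ι d + ι l * ι d + ι μ * σ) - (ι d * ι d + ι μ * (⟦ 1ℤ ⟧ + ι d))
            ≈⟨ +-congʳ (sym countι) ⟩
          (ι d * ι d + ι μ * (⟦ 1ℤ ⟧ + ι d)) - (ι d * ι d + ι μ * (⟦ 1ℤ ⟧ + ι d))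
            ≈⟨ -‿inverseʳ _ ⟩
          0# ∎

      -- Compare coefficients in the span of `M`, `Δ` and `X`: that of `M` agrees identically by the
      -- choice of `b`, that of `Δ` by the discriminant equation, and that of `X` by this and
      -- `count`.
      P-square : ∀ u v → sum (λ w → P u w * P w v) ≈ (⟦ + 2 ⟧ * σ * s) * P u v
      P-square u v = begin
        sum (λ w → P u w * P w v)
          ≈⟨ P∙P u v ⟩
        _ ≈⟨ collect m′ δ′ x′ ⟩
        a * (a * β + ⟦ + 2 ⟧ * b) * m′ + ((a * a * α + b * b) * δ′
          + (a * a * ι μ + ⟦ + 2 ⟧ * (a * c * ι d) + ⟦ + 2 ⟧ * (b * c) + c * c * σ) * x′)
          ≈⟨ +-cong (*-congʳ M-coefficient) (+-cong (*-congʳ Δ-coefficient) (*-congʳ X-coefficient)) ⟩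
        ⟦ + 2 ⟧ * σ * s * a * m′ + (⟦ + 2 ⟧ * σ * s * b * δ′ + ⟦ + 2 ⟧ * σ * s * c * x′)
          ≈⟨ solve 7 (λ e a b c m δ x → e :* a :* m :+ (e :* b :* δ :+ e :* c :* x)
               := e :* (a :* m :+ (b :* δ :+ c :* x))) refl (⟦ + 2 ⟧ * σ * s) a b c m′ δ′ x′ ⟩
        (⟦ + 2 ⟧ * σ * s) * P u v ∎
        where
        m′ = ι (M u v)
        δ′ = ι (Δ u v)
        x′ = ι (X u v)
        M-coefficient : a * (a * β + ⟦ + 2 ⟧ * b) ≈ ⟦ + 2 ⟧ * σ * s * a
        M-coefficient = solve 3 (λ σ β s → let τ = β :- s; a = con (+ 2) :* σ; b = :- (σ :* τ) in
          a :* (a :* β :+ con (+ 2) :* b) := con (+ 2) :* σ :* s :* a) refl σ β s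
        collect : ∀ m δ x →
          a * (a * (α * δ + (β * m + ι μ * x)) + (b * m + c * (ι d * x)))
          + (b * (a * m + (b * δ + c * x)) + c * (a * (ι d * x) + (b * x + c * (σ * x))))
          ≈ a * (a * β + ⟦ + 2 ⟧ * b) * m + ((a * a * α + b * b) * δ
          + (a * a * ι μ + ⟦ + 2 ⟧ * (a * c * ι d) + ⟦ + 2 ⟧ * (b * c) + c * c * σ) * x)
        collect m δ x = solve 11 (λ a b c α β μ d σ m δ x →
          a :* (a :* (α :* δ :+ (β :* m :+ μ :* x)) :+ (b :* m :+ c :* (d :* x)))
          :+ (b :* (a :* m :+ (b :* δ :+ c :* x)) :+ c :* (a :* (d :* x) :+ (b :* x :+ c :* (σ :* x))))
          := a :* (a :* β :+ con (+ 2) :* b) :* m :+ ((a :* a :* α :+ b :* b) :* δ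
          :+ (a :* a :* μ :+ con (+ 2) :* (a :* c :* d) :+ con (+ 2) :* (b :* c) :+ c :* c :* σ) :* x))
          refl a b c α β (ι μ) (ι d) σ m δ x

      P-trace : trace P ≈ (b + c) * σ
      P-trace = begin
        sum (λ u → P u u)
          ≈⟨ sum-linear₃ a b c (λ u → ι (M u u)) (λ u → ι (Δ u u)) (λ u → ι (X u u)) ⟩
        a * sum (λ u → ι (M u u)) + (b * sum (λ u → ι (Δ u u)) + c * sum (λ u → ι (X u u)))
          ≈⟨ +-cong (*-congˡ (diagonal (sum-0 (λ u → M u u) loopless)))
               (+-cong (*-congˡ (diagonal {f = λ u → Δ u u} (≡.trans (ℕΣ.sum-cong-≗ Δ-diagonal) size)))
                       (*-congˡ (diagonal {f = λ u → X u u} (≡.trans (ℕΣ.sum-cong-≗ idempotent) size)))) ⟩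
        a * ⟦ 0ℤ ⟧ + (b * σ + c * σ)
          ≈⟨ solve 4 (λ a b c σ → a :* con 0ℤ :+ (b :* σ :+ c :* σ) := (b :+ c) :* σ) refl a b c σ ⟩
        (b + c) * σ ∎
        where
        diagonal : ∀ {f : Fin n → ℕ} {m} → ℕΣ.sum f ≡ m → sum (λ u → ι (f u)) ≈ ι m
        diagonal {f} eq = trans (sym (ι-sum f)) (reflexive (cong ι eq))
        Δ-diagonal : ∀ u → Δ u u ≡ χ u
        Δ-diagonal u = ≡.trans (cong (χ u ℕ.*_) (𝟙-yes (u Fin.≟ u) ≡.refl)) (ℕ.*-identityʳ (χ u))

      -- Here `m` is the multiplicity of θ = (β + s)/2. With θ' = τ/2 the equation is twice d + mθ +
      -- (ρ - m)θ' = 0, the vanishing of the trace of M; ρ counts the eigenvalues other than that of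
      -- the all-ones vector.
      multiplicity : ∃[ m ] s * ι ρ ≈ β * ι ρ + ⟦ + 2 ⟧ * ι d + ⟦ + 2 ⟧ * ι m * s
      multiplicity = let m , tr = trace-multiple P (⟦ + 2 ⟧ * σ * s) P-square in m , equation m tr
       where
       equation : ∀ m → trace P ≈ ι m * (⟦ + 2 ⟧ * σ * s) →
         s * ι ρ ≈ β * ι ρ + ⟦ + 2 ⟧ * ι d + ⟦ + 2 ⟧ * ι m * s
       equation m tr = begin
        s * ι ρ
          ≈⟨ solve 4 (λ s β d ρ → let τ = β :- s; σ = con 1ℤ :+ ρ in s :* ρ
               := β :* ρ :+ con (+ 2) :* d :+ (:- (σ :* τ) :+ :- (con (+ 2) :* d :- τ))) refl s β (ι d) (ι ρ) ⟩
        β * ι ρ + ⟦ + 2 ⟧ * ι d + (- ((⟦ 1ℤ ⟧ + ι ρ) * τ) + c)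
          ≈⟨ +-congˡ (+-congʳ (-‿cong (*-congʳ (ι-+ 1 ρ)))) ⟨
        β * ι ρ + ⟦ + 2 ⟧ * ι d + (b + c)
          ≈⟨ +-congˡ b+c ⟩
        β * ι ρ + ⟦ + 2 ⟧ * ι d + ⟦ + 2 ⟧ * ι m * s ∎
        where
        b+c : b + c ≈ ⟦ + 2 ⟧ * ι m * s
        b+c = *-cancelˡ σ (b + c) _ (λ σ≈0 → contradiction (⟦⟧-injective₀ (+ suc ρ) σ≈0) λ ()) (begin
          σ * (b + c)                   ≈⟨ *-comm σ _ ⟩
          (b + c) * σ                   ≈⟨ P-trace ⟨
          trace P                       ≈⟨ tr ⟩
          ι m * (⟦ + 2 ⟧ * σ * s)
            ≈⟨ solve 3 (λ m σ s → m :* (con (+ 2) :* σ :* s) := σ :* (con (+ 2) :* m :* s)) refl (ι m) σ s ⟩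
          σ * (⟦ + 2 ⟧ * ι m * s)       ∎)

-- Quadratic integers

NonSquare : ℕ → Set
NonSquare D = ∀ r → r ℕ.* r ≢ D

square? : ∀ D → (∃[ r ] r ℕ.* r ≡ D) ⊎ NonSquare D
square? D with ℕ.anyUpTo? (λ r → r ℕ.* r ℕ.≟ D) (suc D)
... | yes (r , _ , r²≡D) = inj₁ (r , r²≡D)
... | no ∄r = inj₂ λ r r²≡D → ∄r (r , ℕ.s≤s (r≤D r r²≡D) , r²≡D)
  where
  r≤D : ∀ r → r ℕ.* r ≡ D → r ℕ.≤ D
  r≤D zero    _    = ℕ.z≤n
  r≤D (suc r) r²≡D = ℕ.≤-trans (ℕ.m≤m*n (suc r) (suc r)) (ℕ.≤-reflexive r²≡D)

between-squares : ∀ q {D} → q ℕ.* q ℕ.< D → D ℕ.< suc q ℕ.* suc q → NonSquare D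
between-squares q q²<D D<[1+q]² r ≡.refl with r ℕ.≤? q
... | yes r≤q = ℕ.<⇒≱ q²<D (ℕ.*-mono-≤ r≤q r≤q)
... | no  r≰q = ℕ.<⇒≱ D<[1+q]² (ℕ.*-mono-≤ (ℕ.≰⇒> r≰q) (ℕ.≰⇒> r≰q))

-- b divides a² and is coprime to a, so it divides a and equals 1.
coprime-square : ∀ {a b} D → Coprime a b → a ℕ.* a ≡ D ℕ.* (b ℕ.* b) → a ℕ.* a ≡ D
coprime-square {a} {b} D a⊥b eq = begin
  a ℕ.* a           ≡⟨ eq ⟩
  D ℕ.* (b ℕ.* b)   ≡⟨ cong (λ x → D ℕ.* (x ℕ.* x)) b≡1 ⟩
  D ℕ.* 1           ≡⟨ ℕ.*-identityʳ D ⟩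
  D                 ∎
  where
  open ≡.≡-Reasoning
  b≡1 : b ≡ 1
  b≡1 = a⊥b (coprime-divisor (λ { (d∣b , d∣a) → a⊥b (d∣a , d∣b) })
               (divides (D ℕ.* b) (≡.trans eq (≡.sym (ℕ.*-assoc D b b)))) , ∣-refl)

-- Irrationality of √D: with b nonzero, reducing a/b to lowest terms would make D a perfect square.
nonSquare-ratio : ∀ {D} → NonSquare D → ∀ a b → a ℕ.* a ≡ D ℕ.* (b ℕ.* b) → b ≡ 0
nonSquare-ratio ¬□ a zero    _  = ≡.refl
nonSquare-ratio {D} ¬□ a b@(suc _) eq =
  contradiction (coprime-square D (coprime-/gcd a b) reduced) (¬□ (a ℕ./ g))
  where
  open ≡.≡-Reasoning
  g = gcd a b
  instance
    g≢0 : ℕ.NonZero g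
    g≢0 = ℕ.≢-nonZero (gcd[m,n]≢0 a b (inj₂ λ ()))
    g²≢0 : ℕ.NonZero (g ℕ.* g)
    g²≢0 = ℕ.m*n≢0 g g
  a′ = a ℕ./ g
  b′ = b ℕ./ g
  regroup : ∀ x g → x ℕ.* x ℕ.* (g ℕ.* g) ≡ x ℕ.* g ℕ.* (x ℕ.* g)
  regroup = ℕ.solve-∀
  regroup′ : ∀ D x g → D ℕ.* (x ℕ.* g ℕ.* (x ℕ.* g)) ≡ D ℕ.* (x ℕ.* x) ℕ.* (g ℕ.* g)
  regroup′ = ℕ.solve-∀
  reduced : a′ ℕ.* a′ ≡ D ℕ.* (b′ ℕ.* b′)
  reduced = ℕ.*-cancelʳ-≡ _ _ (g ℕ.* g) (begin
    a′ ℕ.* a′ ℕ.* (g ℕ.* g)             ≡⟨ regroup a′ g ⟩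
    a′ ℕ.* g ℕ.* (a′ ℕ.* g)             ≡⟨ cong (λ x → x ℕ.* x) (m/n*n≡m (gcd[m,n]∣m a b)) ⟩
    a ℕ.* a                             ≡⟨ eq ⟩
    D ℕ.* (b ℕ.* b)                     ≡⟨ cong (λ x → D ℕ.* (x ℕ.* x)) (m/n*n≡m (gcd[m,n]∣n a b)) ⟨
    D ℕ.* (b′ ℕ.* g ℕ.* (b′ ℕ.* g))     ≡⟨ regroup′ D b′ g ⟩
    D ℕ.* (b′ ℕ.* b′) ℕ.* (g ℕ.* g)     ∎)

ℤ-domain : Domain
ℤ-domain = record
  { commutativeRing = ℤ.+-*-commutativeRing
  ; morphism        = record
    { ⟦_⟧ = λ z → z ; +-homo = λ _ _ → ≡.refl ; *-homo = λ _ _ → ≡.refl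
    ; -‿homo = λ _ → ≡.refl ; 0-homo = ≡.refl ; 1-homo = ≡.refl }
  ; _≟_             = ℤ._≟_
  ; *-cancel₀       = cancel
  ; ⟦⟧-injective₀   = λ _ z≡0 → z≡0
  }
  where
  cancel : ∀ x y → x ℤ.* y ≡ 0ℤ → x ≢ 0ℤ → y ≡ 0ℤ
  cancel x y xy≡0 x≢0 with ℤ.i*j≡0⇒i≡0∨j≡0 x xy≡0
  ... | inj₁ x≡0 = contradiction x≡0 x≢0
  ... | inj₂ y≡0 = y≡0

-- (a , b) stands for a + b √D.
module QuadraticIntegers (D : ℕ) where
  open import Data.Integer using (_+_; _*_; -_; _-_)

  ℤ[√D] : Set
  ℤ[√D] = ℤ × ℤ

  infixl 6 _⊕_
  infixl 7 _⊗_
  _⊕_ _⊗_ : ℤ[√D] → ℤ[√D] → ℤ[√D]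
  (a , b) ⊕ (c , d) = a + c , b + d
  (a , b) ⊗ (c , d) = a * c + + D * (b * d) , a * d + b * c

  ⊝_ : ℤ[√D] → ℤ[√D]
  ⊝ (a , b) = - a , - b

  integer : ℤ → ℤ[√D]
  integer z = z , 0ℤ

  ⊕-assoc : ∀ x y z → (x ⊕ y) ⊕ z ≡ x ⊕ (y ⊕ z)
  ⊕-assoc (a , b) (c , d) (e , f) = cong₂ _,_ (ℤ.+-assoc a c e) (ℤ.+-assoc b d f)

  ⊕-comm : ∀ x y → x ⊕ y ≡ y ⊕ x
  ⊕-comm (a , b) (c , d) = cong₂ _,_ (ℤ.+-comm a c) (ℤ.+-comm b d)

  ⊗-assoc : ∀ x y z → (x ⊗ y) ⊗ z ≡ x ⊗ (y ⊗ z)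
  ⊗-assoc (a , b) (c , d) (e , f) = cong₂ _,_ (re (+ D) a b c d e f) (im (+ D) a b c d e f)
    where
    re : ∀ D a b c d e f → (a * c + D * (b * d)) * e + D * ((a * d + b * c) * f)
      ≡ a * (c * e + D * (d * f)) + D * (b * (c * f + d * e))
    re = ℤ.solve-∀
    im : ∀ D a b c d e f → (a * c + D * (b * d)) * f + (a * d + b * c) * e
      ≡ a * (c * f + d * e) + b * (c * e + D * (d * f))
    im = ℤ.solve-∀

  ⊗-comm : ∀ x y → x ⊗ y ≡ y ⊗ x
  ⊗-comm (a , b) (c , d) = cong₂ _,_ (re (+ D) a b c d) (im a b c d)
    where
    re : ∀ D a b c d → a * c + D * (b * d) ≡ c * a + D * (d * b)
    re = ℤ.solve-∀
    im : ∀ a b c d → a * d + b * c ≡ c * b + d * a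
    im = ℤ.solve-∀

  ⊗-identityˡ : ∀ x → (1ℤ , 0ℤ) ⊗ x ≡ x
  ⊗-identityˡ (a , b) = cong₂ _,_ (re (+ D) a b) (im a b)
    where
    re : ∀ D a b → 1ℤ * a + D * (0ℤ * b) ≡ a
    re = ℤ.solve-∀
    im : ∀ a b → 1ℤ * b + 0ℤ * a ≡ b
    im = ℤ.solve-∀

  ⊗-distribˡ-⊕ : ∀ x y z → x ⊗ (y ⊕ z) ≡ (x ⊗ y) ⊕ (x ⊗ z)
  ⊗-distribˡ-⊕ (a , b) (c , d) (e , f) = cong₂ _,_ (re (+ D) a b c d e f) (im a b c d e f)
    where
    re : ∀ D a b c d e f → a * (c + e) + D * (b * (d + f))
      ≡ (a * c + D * (b * d)) + (a * e + D * (b * f))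
    re = ℤ.solve-∀
    im : ∀ a b c d e f → a * (d + f) + b * (c + e) ≡ (a * d + b * c) + (a * f + b * e)
    im = ℤ.solve-∀

  integer-⊗ : ∀ x y → integer (x * y) ≡ integer x ⊗ integer y
  integer-⊗ x y = cong₂ _,_ (re (+ D) x y) (im x y)
    where
    re : ∀ D x y → x * y ≡ x * y + D * (0ℤ * 0ℤ)
    re = ℤ.solve-∀
    im : ∀ x y → 0ℤ ≡ x * 0ℤ + 0ℤ * y
    im = ℤ.solve-∀

  commutativeRing : CommutativeRing 0ℓ 0ℓ
  commutativeRing = record
    { Carrier = ℤ[√D] ; _≈_ = _≡_ ; _+_ = _⊕_ ; _*_ = _⊗_ ; -_ = ⊝_
    ; 0# = 0ℤ , 0ℤ ; 1# = 1ℤ , 0ℤ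
    ; isCommutativeRing = record
      { isRing = record
        { +-isAbelianGroup = record
          { isGroup = record
            { isMonoid = record
              { isSemigroup = record
                { isMagma = record { isEquivalence = ≡.isEquivalence ; ∙-cong = cong₂ _⊕_ }
                ; assoc = ⊕-assoc }
              ; identity = comm∧idˡ⇒id ⊕-comm (λ (a , b) → cong₂ _,_ (ℤ.+-identityˡ a) (ℤ.+-identityˡ b)) }
            ; inverse = comm∧invˡ⇒inv ⊕-comm (λ (a , b) → cong₂ _,_ (ℤ.+-inverseˡ a) (ℤ.+-inverseˡ b))
            ; ⁻¹-cong = cong ⊝_ }
          ; comm = ⊕-comm }
        ; *-cong = cong₂ _⊗_
        ; *-assoc = ⊗-assoc
        ; *-identity = comm∧idˡ⇒id ⊗-comm ⊗-identityˡ
        ; distrib = ⊗-distribˡ-⊕ , comm∧distrˡ⇒distrʳ ⊗-comm ⊗-distribˡ-⊕ }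
      ; *-comm = ⊗-comm } }
    where open import Algebra.Consequences.Propositional
            using (comm∧idˡ⇒id; comm∧invˡ⇒inv; comm∧distrˡ⇒distrʳ)

  -- If the norm of p + q√D vanished, then |p|² = D|q|², and irrationality of √D would force q = 0
  -- and then p = 0.
  norm≢0 : NonSquare D → ∀ p q → ¬ (p , q) ≡ (0ℤ , 0ℤ) → p * p - + D * (q * q) ≢ 0ℤ
  norm≢0 ¬□ p q pq≢0 N≡0 = pq≢0 (cong₂ _,_ (ℤ.∣i∣≡0⇒i≡0 ∣p∣≡0) (ℤ.∣i∣≡0⇒i≡0 ∣q∣≡0))
    where
    open ≡.≡-Reasoning
    ∣p∣²≡D∣q∣² : ℤ.∣ p ∣ ℕ.* ℤ.∣ p ∣ ≡ D ℕ.* (ℤ.∣ q ∣ ℕ.* ℤ.∣ q ∣)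
    ∣p∣²≡D∣q∣² = begin
      ℤ.∣ p ∣ ℕ.* ℤ.∣ p ∣           ≡⟨ ℤ.abs-* p p ⟨
      ℤ.∣ p * p ∣                   ≡⟨ cong ℤ.∣_∣ (ℤ.i-j≡0⇒i≡j (p * p) (+ D * (q * q)) N≡0) ⟩
      ℤ.∣ + D * (q * q) ∣           ≡⟨ ℤ.abs-* (+ D) (q * q) ⟩
      D ℕ.* ℤ.∣ q * q ∣             ≡⟨ cong (D ℕ.*_) (ℤ.abs-* q q) ⟩
      D ℕ.* (ℤ.∣ q ∣ ℕ.* ℤ.∣ q ∣)   ∎
    ∣q∣≡0 : ℤ.∣ q ∣ ≡ 0
    ∣q∣≡0 = nonSquare-ratio ¬□ ℤ.∣ p ∣ ℤ.∣ q ∣ ∣p∣²≡D∣q∣²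
    ∣p∣≡0 : ℤ.∣ p ∣ ≡ 0
    ∣p∣≡0 with ℕ.m*n≡0⇒m≡0∨n≡0 ℤ.∣ p ∣ (≡.trans ∣p∣²≡D∣q∣²
                 (≡.trans (cong (λ x → D ℕ.* (x ℕ.* x)) ∣q∣≡0) (ℕ.*-zeroʳ D)))
    ... | inj₁ eq = eq
    ... | inj₂ eq = eq

  domain : NonSquare D → Domain
  domain ¬□ = record
    { commutativeRing = commutativeRing
    ; morphism        = record
      { ⟦_⟧ = integer ; +-homo = λ _ _ → ≡.refl ; *-homo = integer-⊗
      ; -‿homo = λ _ → ≡.refl ; 0-homo = ≡.refl ; 1-homo = ≡.refl }
    ; _≟_             = ≡-dec ℤ._≟_ ℤ._≟_
    ; *-cancel₀       = cancel
    ; ⟦⟧-injective₀   = λ _ → cong proj₁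
    }
    where
    open ≡.≡-Reasoning
    -- Multiplying the product by the conjugate p - q√D turns its vanishing into N a = 0 and N b =
    -- 0, where the norm N is a nonzero integer.
    cancel : ∀ x y → x ⊗ y ≡ (0ℤ , 0ℤ) → ¬ x ≡ (0ℤ , 0ℤ) → y ≡ (0ℤ , 0ℤ)
    cancel (p , q) (a , b) xy≡0 x≢0 = cong₂ _,_ (factor a Na≡0) (factor b Nb≡0)
      where
      N = p * p - + D * (q * q)
      factor : ∀ z → N * z ≡ 0ℤ → z ≡ 0ℤ
      factor z Nz≡0 = Domain.*-cancel₀ ℤ-domain N z Nz≡0 (norm≢0 ¬□ p q x≢0)
      re = p * a + + D * (q * b)
      im = p * b + q * a
      expand-a : ∀ D p q a b → (p * p - D * (q * q)) * a
        ≡ p * (p * a + D * (q * b)) - D * q * (p * b + q * a)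
      expand-a = ℤ.solve-∀
      expand-b : ∀ D p q a b → (p * p - D * (q * q)) * b
        ≡ p * (p * b + q * a) - q * (p * a + D * (q * b))
      expand-b = ℤ.solve-∀
      zeros : ∀ x y → x * 0ℤ - y * 0ℤ ≡ 0ℤ
      zeros = ℤ.solve-∀
      Na≡0 : N * a ≡ 0ℤ
      Na≡0 = begin
        N * a                 ≡⟨ expand-a (+ D) p q a b ⟩
        p * re - + D * q * im ≡⟨ cong₂ (λ x y → p * x - + D * q * y) (cong proj₁ xy≡0) (cong proj₂ xy≡0) ⟩
        p * 0ℤ - + D * q * 0ℤ ≡⟨ zeros p (+ D * q) ⟩
        0ℤ                    ∎
      Nb≡0 : N * b ≡ 0ℤ
      Nb≡0 = begin
        N * b           ≡⟨ expand-b (+ D) p q a b ⟩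
        p * im - q * re ≡⟨ cong₂ (λ x y → p * x - q * y) (cong proj₂ xy≡0) (cong proj₁ xy≡0) ⟩
        p * 0ℤ - q * 0ℤ ≡⟨ zeros p q ⟩
        0ℤ              ∎

-- Integrality conditions

module _ {n : ℕ} {χ : Fin n → ℕ} {M : Fin n → Fin n → ℕ} {d l μ : ℕ}
         (G : StronglyRegular χ M d l μ) (ρ : ℕ) (size : ℕΣ.sum χ ≡ suc ρ) (D : ℕ)
         (discriminant : + D ≡ (+ l ℤ.- + μ) ℤ.* (+ l ℤ.- + μ) ℤ.+ + 4 ℤ.* (+ d ℤ.- + μ)) where
  open import Data.Integer using (_+_; _*_; -_; _-_)
  open ≡.≡-Reasoning

  square-discriminant : ∀ r → r ℕ.* r ≡ D →
    ∃[ m ] + r * + ρ ≡ (+ l - + μ) * + ρ + + 2 * + d + + 2 * + m * + r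
  square-discriminant r r²≡D = DomainMatrices.multiplicity ℤ-domain G ρ size (+ r)
    (≡.trans (≡.sym (ℤ.pos-* r r)) (≡.trans (cong +_ r²≡D) discriminant))

  -- Take s = √D in the multiplicity equation. Both sρ and 2ms are integer multiples of √D, so the
  -- rational part contains only βρ + 2d.
  nonsquare-discriminant : NonSquare D → (+ l - + μ) * + ρ + + 2 * + d ≡ 0ℤ
  nonsquare-discriminant ¬□ = rational-part (proj₁ conjugate) (cong proj₁ (proj₂ conjugate))
    where
    open QuadraticIntegers D
    β = + l - + μ
    α = + d - + μ
    re : ∀ D β α → D ≡ β * β + + 4 * α → 0ℤ * 0ℤ + D * (1ℤ * 1ℤ)
      ≡ (β * β + D * (0ℤ * 0ℤ)) + (+ 4 * α + D * (0ℤ * 0ℤ))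
    re D β α eq = ≡.trans (D*1 D) (≡.trans eq (rearrange D β α))
      where
      D*1 : ∀ D → 0ℤ * 0ℤ + D * (1ℤ * 1ℤ) ≡ D
      D*1 = ℤ.solve-∀
      rearrange : ∀ D β α → β * β + + 4 * α ≡ (β * β + D * (0ℤ * 0ℤ)) + (+ 4 * α + D * (0ℤ * 0ℤ))
      rearrange = ℤ.solve-∀
    im : ∀ β α → 0ℤ * 1ℤ + 1ℤ * 0ℤ ≡ (β * 0ℤ + 0ℤ * β) + (+ 4 * 0ℤ + 0ℤ * α)
    im = ℤ.solve-∀
    conjugate = DomainMatrices.multiplicity (domain ¬□) G ρ size (0ℤ , 1ℤ)
      (cong₂ _,_ (re (+ D) β α discriminant) (im β α))
    rational-part : ∀ m → 0ℤ * + ρ + + D * (1ℤ * 0ℤ)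
      ≡ (β * + ρ + + D * (0ℤ * 0ℤ)) + (+ 2 * + d + + D * (0ℤ * 0ℤ))
        + ((+ 2 * + m + + D * (0ℤ * 0ℤ)) * 0ℤ + + D * ((+ 2 * 0ℤ + 0ℤ * + m) * 1ℤ)) →
      β * + ρ + + 2 * + d ≡ 0ℤ
    rational-part m eq = ≡.trans (simplify-right (+ D) β (+ ρ) (+ d) (+ m))
      (≡.trans (≡.sym eq) (simplify-left (+ D) (+ ρ)))
      where
      simplify-right : ∀ D β ρ d m → β * ρ + + 2 * d
        ≡ (β * ρ + D * (0ℤ * 0ℤ)) + (+ 2 * d + D * (0ℤ * 0ℤ))
          + ((+ 2 * m + D * (0ℤ * 0ℤ)) * 0ℤ + D * ((+ 2 * 0ℤ + 0ℤ * m) * 1ℤ))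
      simplify-right = ℤ.solve-∀
      simplify-left : ∀ D ρ → 0ℤ * ρ + D * (1ℤ * 0ℤ) ≡ 0ℤ
      simplify-left = ℤ.solve-∀

-- Degrees of Moore graphs

MooreDegree : ℕ → Set
MooreDegree k = k ≡ 2 ⊎ k ≡ 3 ⊎ k ≡ 7 ⊎ k ≡ 57

divisor-of-15 : ∀ {r} → r ∣ 15 → r ≡ 1 ⊎ r ≡ 3 ⊎ r ≡ 5 ⊎ r ≡ 15
divisor-of-15 r∣15 = from-yes (ℕ.allUpTo? (λ r → r ∣? 15 →-dec
  (r ℕ.≟ 1 ⊎-dec r ℕ.≟ 3 ⊎-dec r ℕ.≟ 5 ⊎-dec r ℕ.≟ 15)) 16) (ℕ.s≤s (∣⇒≤ r∣15)) r∣15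

module _ {n : ℕ} {χ : Fin n → ℕ} {M : Fin n → Fin n → ℕ} where

  moore-size : ∀ {k} → StronglyRegular χ M k 0 1 → ℕΣ.sum χ ≡ suc (k ℕ.* k)
  moore-size {k} G = ℕ.+-cancelˡ-≡ k _ _ (begin
    k ℕ.+ ℕΣ.sum χ                 ≡⟨ rearrange k (ℕΣ.sum χ) ⟩
    k ℕ.+ 0 ℕ.* k ℕ.+ 1 ℕ.* ℕΣ.sum χ ≡⟨ StronglyRegular.count G ⟨
    k ℕ.* k ℕ.+ 1 ℕ.* suc k        ≡⟨ rearrange′ k ⟩
    k ℕ.+ suc (k ℕ.* k)            ∎)
    where
    open ≡.≡-Reasoning
    rearrange : ∀ k σ → k ℕ.+ σ ≡ k ℕ.+ 0 ℕ.* k ℕ.+ 1 ℕ.* σ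
    rearrange = ℕ.solve-∀
    rearrange′ : ∀ k → k ℕ.* k ℕ.+ 1 ℕ.* (1 ℕ.+ k) ≡ k ℕ.+ (1 ℕ.+ k ℕ.* k)
    rearrange′ = ℕ.solve-∀

  -- Here β = -1 and α = k - 1, so the discriminant is 4k - 3; with k = `suc j` it is 1 + 4j, free
  -- of subtraction.
  moore-discriminant : ∀ j →
    + suc (4 ℕ.* j) ≡ (+ 0 ℤ.- + 1) ℤ.* (+ 0 ℤ.- + 1) ℤ.+ + 4 ℤ.* (+ suc j ℤ.- + 1)
  moore-discriminant j = cong (λ z → 1ℤ ℤ.+ z) (ℤ.pos-* 4 j)

  -- Hoffman and Singleton: if 4k - 3 is a square r², then r divides
  -- 16(k² - 2k) ≡ -15 (mod r).
  moore-degree : ∀ {k} → StronglyRegular χ M k 0 1 → 2 ℕ.≤ k → MooreDegree k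
  moore-degree {suc j} G 2≤k with square? (suc (4 ℕ.* j))
  ... | inj₂ ¬□ = inj₁ (ℕ.*-cancelʳ-≡ k 2 k (ℤ.+-injective (begin
    + (k ℕ.* k)                         ≡⟨ rearrange (+ (k ℕ.* k)) (+ k) ⟩
    + 2 * + k - ((0ℤ - 1ℤ) * + (k ℕ.* k) + + 2 * + k)
      ≡⟨ cong (λ z → + 2 * + k - z) (nonsquare-discriminant G (k ℕ.* k) (moore-size G) (suc (4 ℕ.* j)) (moore-discriminant j) ¬□) ⟩
    + 2 * + k - 0ℤ                      ≡⟨ ℤ.+-identityʳ _ ⟩
    + 2 * + k                           ≡⟨ ℤ.pos-* 2 k ⟨
    + (2 ℕ.* k)                         ∎)))
    where
    open import Data.Integer using (_+_; _*_; -_; _-_)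
    open ≡.≡-Reasoning
    k = suc j
    rearrange : ∀ x k → x ≡ + 2 * k - ((0ℤ - 1ℤ) * x + + 2 * k)
    rearrange = ℤ.solve-∀
  ... | inj₁ (r , r²≡) = from-root (divisor-of-15 (divides ℤ.∣ q ∣ (begin
    15              ≡⟨ cong ℤ.∣_∣ 15≡ ⟩
    ℤ.∣ q * + r ∣   ≡⟨ ℤ.abs-* q (+ r) ⟩
    ℤ.∣ q ∣ ℕ.* r   ∎)))
    where
    open import Data.Integer using (_+_; _*_; -_; _-_)
    open ≡.≡-Reasoning
    k = suc j
    multiplicity = square-discriminant G (k ℕ.* k) (moore-size G) (suc (4 ℕ.* j)) (moore-discriminant j) r r²≡
    m = + proj₁ multiplicity
    q : ℤ
    -- By 4k = r² + 3, the number 16(k² - 2k) = (4k)² - 8(4k) equals r⁴ - 2r² - 15, while the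
    -- multiplicity equation makes it 16(2m - k²)r. Solving for 15 leaves r times this cofactor.
    q = + r * + r * + r - + 2 * + r - + 16 * (+ 2 * m - + k * + k)
    root : + 4 * + k ≡ + r * + r + + 3
    root = begin
      + 4 * + k          ≡⟨ ℤ.pos-* 4 k ⟨
      + (4 ℕ.* suc j)    ≡⟨ cong +_ (4[1+j]≡[1+4j]+3 j) ⟩
      + (suc (4 ℕ.* j)) + + 3 ≡⟨ cong (λ x → + x + + 3) r²≡ ⟨
      + (r ℕ.* r) + + 3  ≡⟨ cong (_+ + 3) (ℤ.pos-* r r) ⟩
      + r * + r + + 3    ∎
      where
      4[1+j]≡[1+4j]+3 : ∀ j → 4 ℕ.* (1 ℕ.+ j) ≡ (1 ℕ.+ 4 ℕ.* j) ℕ.+ 3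
      4[1+j]≡[1+4j]+3 = ℕ.solve-∀
    relation : ∀ r k x m → + 4 * k ≡ r * r + + 3 → x ≡ k * k →
      r * x ≡ (0ℤ - 1ℤ) * x + + 2 * k + + 2 * m * r →
      + 15 ≡ (r * r * r - + 2 * r - + 16 * (+ 2 * m - k * k)) * r
    relation r k x m 4k≡ ≡.refl eq = begin
      + 15
        -- The terms added to the product cancel once 4k = r² + 3 and the multiplicity equation are
        -- substituted.
        ≡⟨ expand r k m ⟩
      (r * r * r - + 2 * r - + 16 * (+ 2 * m - k * k)) * r
        + ((+ 4 * k) * (+ 4 * k) - + 8 * (+ 4 * k) - ((r * r + + 3) * (r * r + + 3) - + 8 * (r * r + + 3))
        + + 16 * ((0ℤ - 1ℤ) * (k * k) + + 2 * k + + 2 * m * r - r * (k * k)))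
        ≡⟨ cong₂ (λ y z → (r * r * r - + 2 * r - + 16 * (+ 2 * m - k * k)) * r
             + (y * y - + 8 * y - ((r * r + + 3) * (r * r + + 3) - + 8 * (r * r + + 3))
             + + 16 * (z - r * (k * k)))) 4k≡ (≡.sym eq) ⟩
      (r * r * r - + 2 * r - + 16 * (+ 2 * m - k * k)) * r
        + ((r * r + + 3) * (r * r + + 3) - + 8 * (r * r + + 3) - ((r * r + + 3) * (r * r + + 3) - + 8 * (r * r + + 3))
        + + 16 * (r * (k * k) - r * (k * k)))
        ≡⟨ collapse ((r * r * r - + 2 * r - + 16 * (+ 2 * m - k * k)) * r)
             ((r * r + + 3) * (r * r + + 3) - + 8 * (r * r + + 3)) (r * (k * k)) ⟩
      (r * r * r - + 2 * r - + 16 * (+ 2 * m - k * k)) * r ∎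
      where
      expand : ∀ r k m → + 15 ≡ (r * r * r - + 2 * r - + 16 * (+ 2 * m - k * k)) * r
        + ((+ 4 * k) * (+ 4 * k) - + 8 * (+ 4 * k) - ((r * r + + 3) * (r * r + + 3) - + 8 * (r * r + + 3))
        + + 16 * ((0ℤ - 1ℤ) * (k * k) + + 2 * k + + 2 * m * r - r * (k * k)))
      expand = ℤ.solve-∀
      collapse : ∀ x y z → x + (y - y + + 16 * (z - z)) ≡ x
      collapse = ℤ.solve-∀
    15≡ : + 15 ≡ q * + r
    15≡ = relation (+ r) (+ k) (+ (k ℕ.* k)) m root (ℤ.pos-* k k) (proj₂ multiplicity)
    from-square : ∀ i → 4 ℕ.* j ≡ 4 ℕ.* i → k ≡ suc i
    from-square i eq = cong suc (ℕ.*-cancelˡ-≡ j i 4 eq)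
    -- k = (r² + 3)/4 takes the values 1, 3, 7 and 57; the first is excluded by `2≤k`. The arguments
    -- of `from-square` are the corresponding k - 1.
    from-root : r ≡ 1 ⊎ r ≡ 3 ⊎ r ≡ 5 ⊎ r ≡ 15 → MooreDegree k
    from-root (inj₁ ≡.refl) = contradiction (from-square 0 (ℕ.suc-injective (≡.sym r²≡)))
      (ℕ.>⇒≢ 2≤k)
    from-root (inj₂ (inj₁ ≡.refl)) = inj₂ (inj₁ (from-square 2 (ℕ.suc-injective (≡.sym r²≡))))
    from-root (inj₂ (inj₂ (inj₁ ≡.refl))) = inj₂ (inj₂ (inj₁ (from-square 6 (ℕ.suc-injective (≡.sym r²≡)))))
    from-root (inj₂ (inj₂ (inj₂ ≡.refl))) = inj₂ (inj₂ (inj₂ (from-square 56 (ℕ.suc-injective (≡.sym r²≡)))))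

  moore-degree-impossible : ∀ {k ρ} → MooreDegree k → ℕΣ.sum χ ≡ suc ρ →
    ¬ StronglyRegular χ M (suc (k ℕ.* k)) k 2
  moore-degree-impossible {ρ = ρ} k∈ size = refute k∈
    where
    -- For i = k - 2 and d = k² the left side is βρ plus twice the degree k² + 1 of G, with β = k -
    -- 2; no summand is negative and the last is positive.
    positive : ∀ i d → (+ (2 ℕ.+ i) ℤ.- + 2) ℤ.* + ρ ℤ.+ + 2 ℤ.* + suc d ≢ 0ℤ
    positive i d eq = ℕ.m+1+n≢0 (i ℕ.* ρ) (ℤ.+-injective (≡.trans
      (≡.trans (ℤ.pos-+ (i ℕ.* ρ) (2 ℕ.* suc d)) (cong₂ ℤ._+_ (ℤ.pos-* i ρ) (ℤ.pos-* 2 (suc d)))) eq))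
    refute : ∀ {k} → MooreDegree k → ¬ StronglyRegular χ M (suc (k ℕ.* k)) k 2
    -- In each case the arguments of `positive` are k - 2 and k², and k(5k - 4) lies strictly
    -- between the squares of two consecutive integers.
    refute (inj₁ ≡.refl) G = positive 0 4
      (nonsquare-discriminant G ρ size 12 ≡.refl
        (between-squares 3 (from-yes (9 ℕ.<? 12)) (from-yes (12 ℕ.<? 16))))
    refute (inj₂ (inj₁ ≡.refl)) G = positive 1 9
      (nonsquare-discriminant G ρ size 33 ≡.refl
        (between-squares 5 (from-yes (25 ℕ.<? 33)) (from-yes (33 ℕ.<? 36))))
    refute (inj₂ (inj₂ (inj₁ ≡.refl))) G = positive 5 49
      (nonsquare-discriminant G ρ size 217 ≡.refl
        (between-squares 14 (from-yes (196 ℕ.<? 217)) (from-yes (217 ℕ.<? 225))))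
    refute (inj₂ (inj₂ (inj₂ ≡.refl))) G = positive 55 3249
      (nonsquare-discriminant G ρ size 16017 ≡.refl
        (between-squares 126 (from-yes (15876 ℕ.<? 16017)) (from-yes (16017 ℕ.<? 16129))))

-- Graphs satisfying (i) and (ii)

open import Relation.Binary.PropositionalEquality using (refl)

module BijoinedGraph {n : ℕ} (G : Graph n) (bijoined : Condition-i G) (K₄-free : Condition-ii G) where
  open Graph G renaming (sym to adj-sym)
  open import Data.Nat using (_+_; _*_)
  open ℕΣ
  open ≡.≡-Reasoning

  A : Fin n → Fin n → ℕ
  A u v = 𝟙 (adj? u v)

  A-sym : ∀ u v → A u v ≡ A v u
  A-sym u v = 𝟙-cong (adj? u v) (adj? v u) (adj-sym u v) (adj-sym v u)

  Local : Fin n → Fin n → Fin n → Set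
  Local v x y = Adj v x × Adj v y × Adj x y

  local? : ∀ v x y → Dec (Local v x y)
  local? v x y = adj? v x ×-dec adj? v y ×-dec adj? x y

  L : Fin n → Fin n → Fin n → ℕ
  L v x y = 𝟙 (local? v x y)

  κ : Fin n → Fin n → ℕ
  κ v x = sum (L v x)

  Local-sym : ∀ {v x y} → Local v x y → Local v y x
  Local-sym (vx , vy , xy) = vy , vx , adj-sym _ _ xy

  L-sym : ∀ v x y → L v x y ≡ L v y x
  L-sym v x y = 𝟙-cong (local? v x y) (local? v y x) Local-sym Local-sym

  L-support : ∀ v x y → L v x y * A v y ≡ L v x y
  L-support v x y = ≡.trans (𝟙-* (local? v x y) (adj? v y))
    (𝟙-cong _ (local? v x y) proj₁ (λ l → l , proj₁ (proj₂ l)))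

  -- Both sides count the triangles that contain v and x.
  κ-sym : ∀ v x → κ v x ≡ κ x v
  κ-sym v x = sum-cong-≗ (λ w → 𝟙-cong (local? v x w) (local? x v w) (swap v x w) (swap x v w))
    where
    swap : ∀ v x w → Local v x w → Local x v w
    swap v x w (vx , vw , xw) = adj-sym v x vx , xw , vw

  -- v is one of the two common neighbours that (i) gives for x and y. The other one is adjacent to
  -- v, since the two are adjacent to each other, and so lies in N(v).
  local-common-neighbour : ∀ {v x y} → Adj v x → Adj v y → x ≢ y → ¬ Adj x y →
    ∃[ c ] (Local v x c × Local v c y × (∀ w → Local v x w → Adj w y → w ≡ c))
  local-common-neighbour {v} {x} {y} vx vy x≢y x≁y with bijoined x y x≢y x≁y
  ... | a , b , _ , (xa , ya) , (xb , yb) , ab , only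
      with only v (adj-sym v x vx , adj-sym v y vy)
  ... | inj₁ refl = b , (vx , ab , xb) , (ab , vy , adj-sym y b yb) ,
    λ w (_ , vw , xw) wy → [ (λ { refl → contradiction vw (irrefl v) }) , (λ w≡b → w≡b) ]′
      (only w (xw , adj-sym w y wy))
  ... | inj₂ refl = a , (vx , va , xa) , (va , vy , adj-sym y a ya) ,
    λ w (_ , vw , xw) wy → [ (λ w≡a → w≡a) , (λ { refl → contradiction vw (irrefl v) }) ]′
      (only w (xw , adj-sym w y wy))
    where va = adj-sym a v ab

  L² : Fin n → Fin n → Fin n → ℕ
  L² v x y = sum (λ w → L v x w * L v w y)

  L²-cong : ∀ v x y {f : Fin n → ℕ} →
    (∀ w → 𝟙 (local? v x w ×-dec local? v w y) ≡ f w) → L² v x y ≡ sum f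
  L²-cong v x y eq = sum-cong-≗ (λ w → ≡.trans (𝟙-* (local? v x w) (local? v w y)) (eq w))

  L²-empty : ∀ v x y → (∀ w → Local v x w → Local v w y → ⊥) → L² v x y ≡ 0
  L²-empty v x y none = ≡.trans
    (L²-cong v x y (λ w → 𝟙-no (local? v x w ×-dec local? v w y) (λ (p , q) → none w p q)))
    (sum-replicate-zero n)

  -- On the diagonal a walk of length two is an edge and back, which gives `κ`. The ends of an edge
  -- of N(v) have no common neighbour there, or v would complete a clique of size four; distinct
  -- nonadjacent vertices have exactly one. The degree stays a function of x because regularity is
  -- still to be derived.
  L-square : ∀ v x y →
    L² v x y + (L v x y + A v x * δ x y) ≡ κ v x * δ x y + A v x * A v y
  L-square v x y = cases (adj? v x) (adj? v y) (x Fin.≟ y) (adj? x y)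
    where
    entry : ∀ {S l a e k b S′ l′ a′ e′ b′} → S ≡ S′ → l ≡ l′ → a ≡ a′ → e ≡ e′ → b ≡ b′ →
      S′ + (l′ + a′ * e′) ≡ k * e′ + a′ * b′ → S + (l + a * e) ≡ k * e + a * b
    entry refl refl refl refl refl eq = eq

    cases : Dec (Adj v x) → Dec (Adj v y) → Dec (x ≡ y) → Dec (Adj x y) →
      L² v x y + (L v x y + A v x * δ x y) ≡ κ v x * δ x y + A v x * A v y
    cases (no ¬vx) _ _ _ = entry {k = κ v x}
      (L²-empty v x y (λ w l _ → ¬vx (proj₁ l)))
      (𝟙-no (local? v x y) (λ l → ¬vx (proj₁ l)))
      (𝟙-no (adj? v x) ¬vx) refl refl
      (cong (λ z → z * δ x y + 0) (≡.sym (sum-0 (L v x) (λ w → 𝟙-no (local? v x w) (λ l → ¬vx (proj₁ l))))))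
    cases (yes vx) (no ¬vy) _ _ = entry {k = κ v x}
      (L²-empty v x y (λ w _ l → ¬vy (proj₁ (proj₂ l))))
      (𝟙-no (local? v x y) (λ l → ¬vy (proj₁ (proj₂ l))))
      (𝟙-yes (adj? v x) vx) (𝟙-no (x Fin.≟ y) (λ { refl → ¬vy vx })) (𝟙-no (adj? v y) ¬vy)
      (cong (_+ 0) (≡.sym (ℕ.*-zeroʳ (κ v x))))
    cases (yes vx) (yes vy) (yes refl) _ = entry {k = κ v x}
      (L²-cong v x x (λ w → 𝟙-cong _ (local? v x w) proj₁ (λ l → l , Local-sym l)))
      (𝟙-no (local? v x x) (λ l → irrefl x (proj₂ (proj₂ l))))
      (𝟙-yes (adj? v x) vx) (𝟙-yes (x Fin.≟ x) refl) (𝟙-yes (adj? v x) vx)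
      (cong (_+ 1) (≡.sym (ℕ.*-identityʳ (κ v x))))
    cases (yes vx) (yes vy) (no x≢y) (yes xy) = entry {k = κ v x}
      (L²-empty v x y (λ w (_ , vw , xw) (_ , _ , wy) → K₄-free v x y w (vx , vy , vw , xy , xw , adj-sym w y wy)))
      (𝟙-yes (local? v x y) (vx , vy , xy))
      (𝟙-yes (adj? v x) vx) (𝟙-no (x Fin.≟ y) x≢y) (𝟙-yes (adj? v y) vy)
      (cong (_+ 1) (≡.sym (ℕ.*-zeroʳ (κ v x))))
    cases (yes vx) (yes vy) (no x≢y) (no x≁y) =
      let c , xc , cy , unique = local-common-neighbour vx vy x≢y x≁y in entry {k = κ v x}
      (≡.trans (L²-cong v x y (λ w → 𝟙-cong _ (w Fin.≟ c)
        (λ (xw , _ , _ , wy) → unique w xw wy) (λ { refl → xc , cy }))) (sum-δ c))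
      (𝟙-no (local? v x y) (λ l → x≁y (proj₂ (proj₂ l))))
      (𝟙-yes (adj? v x) vx) (𝟙-no (x Fin.≟ y) x≢y) (𝟙-yes (adj? v y) vy)
      (cong (_+ 1) (≡.sym (ℕ.*-zeroʳ (κ v x))))

  L³-assoc : ∀ v x y → sum (λ w → L v x w * L² v w y) ≡ sum (λ w → L² v x w * L v w y)
  L³-assoc v x y = begin
    sum (λ w → L v x w * L² v w y)
      ≡⟨ sum-cong-≗ (λ w → *-distribˡ-sum (L v x w) (λ z → L v w z * L v z y)) ⟩
    sum (λ w → sum (λ z → L v x w * (L v w z * L v z y)))
      ≡⟨ ∑-comm (λ w z → L v x w * (L v w z * L v z y)) ⟩
    sum (λ z → sum (λ w → L v x w * (L v w z * L v z y)))
      ≡⟨ sum-cong-≗ (λ z → ≡.trans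
           (sum-cong-≗ (λ w → ≡.sym (ℕ.*-assoc (L v x w) (L v w z) (L v z y))))
           (≡.sym (*-distribʳ-sum (L v z y) (λ w → L v x w * L v w z)))) ⟩
    sum (λ z → L² v x z * L v z y) ∎

  -- Entry (x , y) of L (L² + L + I) computed with L-square.
  L-L-square : ∀ v x y → sum (λ w → L v x w * L² v w y) + (L² v x y + L v x y)
    ≡ κ v y * L v x y + κ v x * A v y
  L-L-square v x y = begin
    T + (L² v x y + L v x y)
      ≡⟨ cong (λ z → T + (L² v x y + z)) (sum-δʳ y (L v x)) ⟨
    T + (L² v x y + sum (λ w → L v x w * δ w y))
      ≡⟨ cong (λ z → T + z) (∑-distrib-+ (λ w → L v x w * L v w y) (λ w → L v x w * δ w y)) ⟨
    T + sum (λ w → L v x w * L v w y + L v x w * δ w y)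
      ≡⟨ ∑-distrib-+ (λ w → L v x w * L² v w y) (λ w → L v x w * L v w y + L v x w * δ w y) ⟨
    sum (λ w → L v x w * L² v w y + (L v x w * L v w y + L v x w * δ w y))
      ≡⟨ sum-cong-≗ pointwise ⟩
    sum (λ w → L v x w * κ v w * δ w y + L v x w * A v y)
      ≡⟨ ∑-distrib-+ (λ w → L v x w * κ v w * δ w y) (λ w → L v x w * A v y) ⟩
    sum (λ w → L v x w * κ v w * δ w y) + sum (λ w → L v x w * A v y)
      ≡⟨ cong₂ _+_ (≡.trans (sum-δʳ y (λ w → L v x w * κ v w)) (ℕ.*-comm (L v x y) (κ v y)))
                   (≡.sym (*-distribʳ-sum (A v y) (L v x))) ⟩
    κ v y * L v x y + κ v x * A v y ∎
    where
    T = sum (λ w → L v x w * L² v w y)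
    expand : ∀ l a s m e → l * a ≡ l → l * s + (l * m + l * e) ≡ l * (s + (m + a * e))
    expand l a s m e la≡l = ≡.trans (cong (λ z → l * s + (l * m + z * e)) (≡.sym la≡l)) (distribute l a s m e)
      where
      distribute : ∀ l a s m e → l * s + (l * m + l * a * e) ≡ l * (s + (m + a * e))
      distribute = ℕ.solve-∀
    collect : ∀ l a k e b → l * a ≡ l → l * (k * e + a * b) ≡ l * k * e + l * b
    collect l a k e b la≡l = ≡.trans (distribute l a k e b) (cong (λ z → l * k * e + z * b) la≡l)
      where
      distribute : ∀ l a k e b → l * (k * e + a * b) ≡ l * k * e + l * a * b
      distribute = ℕ.solve-∀
    pointwise : ∀ w → L v x w * L² v w y + (L v x w * L v w y + L v x w * δ w y)
      ≡ L v x w * κ v w * δ w y + L v x w * A v y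
    pointwise w = begin
      L v x w * L² v w y + (L v x w * L v w y + L v x w * δ w y)
        ≡⟨ expand (L v x w) (A v w) (L² v w y) (L v w y) (δ w y) (L-support v x w) ⟩
      L v x w * (L² v w y + (L v w y + A v w * δ w y))
        ≡⟨ cong (L v x w *_) (L-square v w y) ⟩
      L v x w * (κ v w * δ w y + A v w * A v y)
        ≡⟨ collect (L v x w) (A v w) (κ v w) (δ w y) (A v y) (L-support v x w) ⟩
      L v x w * κ v w * δ w y + L v x w * A v y ∎

  L²-sym : ∀ v x y → L² v x y ≡ L² v y x
  L²-sym v x y = sum-cong-≗ (λ w → ≡.trans (ℕ.*-comm (L v x w) (L v w y))
    (cong₂ _*_ (L-sym v w y) (L-sym v x w)))

  -- L commutes with L² + L + I = diag κ + J.
  κ-commute : ∀ v x y → κ v y * L v x y + κ v x * A v y ≡ κ v x * L v y x + κ v y * A v x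
  κ-commute v x y = begin
    κ v y * L v x y + κ v x * A v y
      ≡⟨ L-L-square v x y ⟨
    sum (λ w → L v x w * L² v w y) + (L² v x y + L v x y)
      ≡⟨ cong₂ _+_ transpose (cong₂ _+_ (L²-sym v x y) (L-sym v x y)) ⟩
    sum (λ w → L v y w * L² v w x) + (L² v y x + L v y x)
      ≡⟨ L-L-square v y x ⟩
    κ v x * L v y x + κ v y * A v x ∎
    where
    transpose : sum (λ w → L v x w * L² v w y) ≡ sum (λ w → L v y w * L² v w x)
    transpose = ≡.trans (L³-assoc v x y) (sum-cong-≗ (λ w →
      ≡.trans (ℕ.*-comm (L² v x w) (L v w y)) (cong₂ _*_ (L-sym v w y) (L²-sym v x w))))

  -- At a pair with L x y = 0 the contributions of diag κ to `κ-commute` disappear, and those of J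
  -- are κ v x on one side and κ v y on the other.
  κ-nonadjacent : ∀ {v x y} → Adj v x → Adj v y → ¬ Adj x y → κ v x ≡ κ v y
  κ-nonadjacent {v} {x} {y} vx vy x≁y = begin
    κ v x                               ≡⟨ rearrange (κ v x) (κ v y) ⟩
    κ v y * 0 + κ v x * 1               ≡⟨ cong₂ (λ l a → κ v y * l + κ v x * a) Lxy≡0 (𝟙-yes (adj? v y) vy) ⟨
    κ v y * L v x y + κ v x * A v y     ≡⟨ κ-commute v x y ⟩
    κ v x * L v y x + κ v y * A v x     ≡⟨ cong₂ (λ l a → κ v x * l + κ v y * a)
                                             (≡.trans (L-sym v y x) Lxy≡0) (𝟙-yes (adj? v x) vx) ⟩
    κ v x * 0 + κ v y * 1               ≡⟨ rearrange (κ v y) (κ v x) ⟨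
    κ v y                               ∎
    where
    Lxy≡0 = 𝟙-no (local? v x y) (λ l → x≁y (proj₂ (proj₂ l)))
    rearrange : ∀ a b → a ≡ b * 0 + a * 1
    rearrange = ℕ.solve-∀

  TwoCommon : Fin n → Fin n → Set
  TwoCommon v x = ∃[ p ] ∃[ q ] (p ≢ q × CommonNbr G v x p × CommonNbr G v x q)

  common? : ∀ v x w → Dec (CommonNbr G v x w)
  common? v x w = adj? v w ×-dec adj? x w

  another-common : ∀ {v x} → TwoCommon v x → ∀ y → ∃[ z ] (z ≢ y × CommonNbr G v x z)
  another-common (p , q , p≢q , cp , cq) y with p Fin.≟ y
  ... | no  p≢y  = p , p≢y , cp
  ... | yes refl = q , p≢q ∘ ≡.sym , cq

  -- A vertex of local degree at most one would make N(v) a star, whose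
  -- centre is universal.
  two-common : ¬ ∃ (Universal G) → ∀ {v x} → Adj v x → TwoCommon v x
  two-common ∄universal {v} {x} vx with any? (common? v x)
  ... | no ∄y = contradiction (v , v-universal) ∄universal
    where
    only-x : ∀ z → Adj v z → z ≡ x
    only-x z vz with z Fin.≟ x
    ... | yes z≡x = z≡x
    -- If z is adjacent to x it is itself a neighbour of x in N(v); otherwise x and z share one
    -- there. But x has none.
    ... | no  z≢x = contradiction
      (let c , (_ , vc , xc) , _ = local-common-neighbour vx vz (z≢x ∘ ≡.sym) (λ xz → ∄y (z , vz , xz))
       in c , vc , xc) ∄y
    -- A vertex not adjacent to v would need two distinct common neighbours with v, while N(v)
    -- contains only x.
    v-universal : Universal G v
    v-universal u u≢v with adj? v u
    ... | yes vu = vu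
    ... | no v≁u with bijoined v u (u≢v ∘ ≡.sym) v≁u
    ...   | a , b , a≢b , (va , _) , (vb , _) , _ =
      contradiction (≡.trans (only-x a va) (≡.sym (only-x b vb))) a≢b
  ... | yes (y , vy , xy) with any? (λ z → ¬? (z Fin.≟ y) ×-dec common? v x z)
  ...   | yes (z , z≢y , cz) = y , z , z≢y ∘ ≡.sym , (vy , xy) , cz
  ...   | no ∄z = contradiction (y , y-universal) ∄universal
    where
    only-y : ∀ z → CommonNbr G v x z → z ≡ y
    only-y z cz = decidable-stable (z Fin.≟ y) (λ z≢y → ∄z (z , z≢y , cz))
    -- Apart from x and y, no vertex of N(v) is adjacent to x, so it shares a neighbour with x
    -- inside N(v), and that neighbour can only be y.
    star : ∀ z → Adj v z → z ≢ y → Adj y z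
    star z vz z≢y with x Fin.≟ z
    ... | yes refl = adj-sym x y xy
    ... | no x≢z with local-common-neighbour vx vz x≢z (λ xz → z≢y (only-y z (vz , xz)))
    ...   | c , (_ , vc , xc) , (_ , _ , cz) , _ with only-y c (vc , xc)
    ...     | refl = cz
    y-universal : Universal G y
    y-universal u u≢y with adj? v u | v Fin.≟ u
    ... | yes vu | _ = star u vu u≢y
    ... | no v≁u | yes refl = adj-sym v y vy
    ... | no v≁u | no v≢u with bijoined v u v≢u v≁u
    ...   | a , b , _ , (va , ua) , (vb , ub) , ab , _ with a Fin.≟ y | b Fin.≟ y
    ...     | yes refl | _        = adj-sym u y ua
    ...     | no _     | yes refl = adj-sym u y ub
    -- The common neighbours a and b of v and u are adjacent to each other and, by `star`, to y. If
    -- neither were y, then v, y, a, b would form a clique.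
    ...     | no a≢y   | no b≢y   = contradiction
      (vy , va , vb , star a va a≢y , star b vb b≢y , ab) (K₄-free v y a b)

  -- Parameters of a graph without universal vertex

  module _ (∄universal : ¬ ∃ (Universal G)) where

    -- Give x and y further neighbours x′ and y′ in N(v). Then x, y′, x′, y are successively
    -- nonadjacent, so `κ-nonadjacent` applies three times: an edge x y′ or x′ y would close a
    -- triangle in N(v), and an edge y′ x′ a 4-cycle.
    κ-adjacent : ∀ {v x y} → Adj v x → Adj v y → Adj x y → κ v x ≡ κ v y
    κ-adjacent {v} {x} {y} vx vy xy
      with another-common (two-common ∄universal vx) y | another-common (two-common ∄universal vy) x
    ... | x′ , x′≢y , vx′ , xx′ | y′ , y′≢x , vy′ , yy′ = begin
      κ v x   ≡⟨ κ-nonadjacent vx vy′ x≁y′ ⟩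
      κ v y′  ≡⟨ κ-nonadjacent vy′ vx′ y′≁x′ ⟩
      κ v x′  ≡⟨ κ-nonadjacent vx′ vy x′≁y ⟩
      κ v y   ∎
      where
      x≁y′ : ¬ Adj x y′
      x≁y′ xy′ = K₄-free v x y y′ (vx , vy , vy′ , xy , xy′ , yy′)
      x′≁y : ¬ Adj x′ y
      x′≁y x′y = K₄-free v x y x′ (vx , vy , vx′ , xy , xx′ , adj-sym x′ y x′y)
      y′≁x′ : ¬ Adj y′ x′
      -- x′ and y would be two different common neighbours of the nonadjacent vertices x and y′
      -- inside N(v).
      y′≁x′ y′x′ with local-common-neighbour vx vy′ (y′≢x ∘ ≡.sym) x≁y′
      ... | c , _ , _ , unique = x′≢y (≡.trans
        (unique x′ (vx , vx′ , xx′) (adj-sym y′ x′ y′x′))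
        (≡.sym (unique y (vx , vy , xy) yy′)))

    κ-local : ∀ {v x y} → Adj v x → Adj v y → κ v x ≡ κ v y
    κ-local {v} {x} {y} vx vy with adj? x y
    ... | yes xy = κ-adjacent vx vy xy
    ... | no x≁y = κ-nonadjacent vx vy x≁y

    -- `κ-local` moves between edges at a vertex and `κ-sym` passes to the other end of an edge. By
    -- (i) at most two edges separate u from v.
    κ-constant : ∀ {u x v y} → Adj u x → Adj v y → κ u x ≡ κ v y
    κ-constant {u} {x} {v} {y} ux vy with u Fin.≟ v | adj? u v
    ... | yes refl | _ = κ-local ux vy
    ... | no _ | yes uv = through-edge ux uv vy
      where
      through-edge : ∀ {u x v y} → Adj u x → Adj u v → Adj v y → κ u x ≡ κ v y
      through-edge {u} {x} {v} {y} ux uv vy =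
        ≡.trans (κ-local ux uv) (≡.trans (κ-sym u v) (κ-local (adj-sym u v uv) vy))
    ... | no u≢v | no u≁v with bijoined u v u≢v u≁v
    ...   | w , _ , _ , (uw , vw) , _ = begin
      κ u x ≡⟨ κ-local ux uw ⟩
      κ u w ≡⟨ κ-sym u w ⟩
      κ w u ≡⟨ κ-local (adj-sym u w uw) (adj-sym v w vw) ⟩
      κ w v ≡⟨ κ-sym w v ⟩
      κ v w ≡⟨ κ-local vw vy ⟩
      κ v y ∎

    -- (i) would give an isolated vertex a neighbour if there were any other vertex. So it is alone
    -- in the graph, and vacuously universal.
    has-neighbour : ∀ v → ∃ (Adj v)
    has-neighbour v with any? (adj? v)
    ... | yes neighbour = neighbour
    ... | no ∄neighbour = contradiction (v , v-universal) ∄universal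
      where
      v-universal : Universal G v
      v-universal u u≢v with bijoined v u (u≢v ∘ ≡.sym) (λ vu → ∄neighbour (u , vu))
      ... | a , _ , _ , (va , _) , _ = contradiction (a , va) ∄neighbour

    2≤κ : ∀ {v x} → Adj v x → 2 ℕ.≤ κ v x
    2≤κ {v} {x} vx with two-common ∄universal vx
    ... | p , q , p≢q , (vp , xp) , (vq , xq) =
      subst (ℕ._≤ κ v x) (≡.trans (∑-distrib-+ (λ w → δ w p) (λ w → δ w q)) (cong₂ _+_ (sum-δ p) (sum-δ q)))
        (sum-mono-≤ {f = λ w → δ w p + δ w q} pointwise)
      where
      pointwise : ∀ w → δ w p + δ w q ℕ.≤ L v x w
      pointwise w with w Fin.≟ p | w Fin.≟ q
      ... | yes refl | yes p≡q  = contradiction p≡q p≢q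
      ... | yes refl | no _     = ℕ.≤-reflexive (≡.sym (𝟙-yes (local? v x p) (vx , vp , xp)))
      ... | no _     | yes refl = ℕ.≤-reflexive (≡.sym (𝟙-yes (local? v x q) (vx , vq , xq)))
      ... | no _     | no _     = ℕ.z≤n

    module _ {k : ℕ} (κ≡k : ∀ {v x} → Adj v x → κ v x ≡ k) where

      κ≡k*A : ∀ v x → κ v x ≡ k * A v x
      κ≡k*A v x = cases (adj? v x)
        where
        cases : Dec (Adj v x) → κ v x ≡ k * A v x
        cases (yes vx) = ≡.trans (κ≡k vx) (≡.sym (≡.trans (cong (k *_) (𝟙-yes (adj? v x) vx)) (ℕ.*-identityʳ k)))
        cases (no v≁x) = ≡.trans (sum-0 (L v x) (λ w → 𝟙-no (local? v x w) (v≁x ∘ proj₁)))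
          (≡.sym (≡.trans (cong (k *_) (𝟙-no (adj? v x) v≁x)) (ℕ.*-zeroʳ k)))

      local-moore : ∀ v → StronglyRegular (A v) (L v) k 0 1
      local-moore v = record
        { vertex     = proj₁ (has-neighbour v)
        ; χ-vertex   = 𝟙-yes (adj? v _) (proj₂ (has-neighbour v))
        ; idempotent = λ u → ≡.trans (𝟙-* (adj? v u) (adj? v u)) (𝟙-cong _ (adj? v u) proj₁ (λ a → a , a))
        ; loopless   = λ u → 𝟙-no (local? v u u) (λ l → irrefl u (proj₂ (proj₂ l)))
        ; symmetric  = L-sym v
        ; support    = L-support v
        ; regular    = κ≡k*A v
        ; square     = λ x y → begin
            L² v x y + 1 * (L v x y + A v x * δ x y)
              ≡⟨ cong (λ z → L² v x y + z) (ℕ.*-identityˡ (L v x y + A v x * δ x y)) ⟩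
            L² v x y + (L v x y + A v x * δ x y)
              ≡⟨ L-square v x y ⟩
            κ v x * δ x y + A v x * A v y
              ≡⟨ cong (λ z → z * δ x y + A v x * A v y) (κ≡k*A v x) ⟩
            k * A v x * δ x y + A v x * A v y
              ≡⟨ rearrange k (A v x) (δ x y) (L v x y) (A v y) ⟩
            k * (A v x * δ x y) + 0 * L v x y + 1 * (A v x * A v y) ∎
        }
        where
        rearrange : ∀ k a e l b → k * a * e + a * b ≡ k * (a * e) + 0 * l + 1 * (a * b)
        rearrange = ℕ.solve-∀

      degree : ∀ v → sum (A v) ≡ suc (k * k)
      degree v = moore-size (local-moore v)

      -- The degree of v is the order k² + 1 of the Moore graph on N(v). The common neighbours of
      -- adjacent u and v are the neighbours of v inside N(u), so `κ` counts them; nonadjacent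
      -- vertices have two by (i).
      strongly-regular : Fin n → StronglyRegular (λ _ → 1) A (suc (k * k)) k 2
      strongly-regular o = record
        { vertex     = o
        ; χ-vertex   = refl
        ; idempotent = λ _ → refl
        ; loopless   = λ u → 𝟙-no (adj? u u) (irrefl u)
        ; symmetric  = A-sym
        ; support    = λ u v → ℕ.*-identityʳ (A u v)
        ; regular    = λ u → ≡.trans (degree u) (≡.sym (ℕ.*-identityʳ (suc (k * k))))
        ; square     = λ u v → square u v (u Fin.≟ v) (adj? u v)
        }
        where
        paths : ∀ u v {f : Fin n → ℕ} → (∀ w → 𝟙 (common? u v w) ≡ f w) →
          sum (λ w → A u w * A w v) ≡ sum f
        paths u v eq = sum-cong-≗ (λ w → ≡.trans (cong (A u w *_) (A-sym w v))
          (≡.trans (𝟙-* (adj? u w) (adj? v w)) (eq w)))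

        entry : ∀ {S a e} d S′ a′ e′ → S ≡ S′ → a ≡ a′ → e ≡ e′ →
          S′ + 2 * (a′ + 1 * e′) ≡ d * (1 * e′) + k * a′ + 2 →
          S + 2 * (a + 1 * e) ≡ d * (1 * e) + k * a + 2
        entry _ _ _ _ refl refl refl eq = eq

        square : ∀ u v → Dec (u ≡ v) → Dec (Adj u v) →
          sum (λ w → A u w * A w v) + 2 * (A u v + 1 * δ u v)
            ≡ suc (k * k) * (1 * δ u v) + k * A u v + 2
        square u v (yes refl) _ = entry (suc (k * k)) (suc (k * k)) 0 1
          (≡.trans (paths u u (λ w → 𝟙-cong _ (adj? u w) proj₁ (λ a → a , a))) (degree u))
          (𝟙-no (adj? u u) (irrefl u)) (𝟙-yes (u Fin.≟ u) refl) (diagonal (suc (k * k)) k)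
          where
          diagonal : ∀ d k → d + 2 ≡ d * 1 + k * 0 + 2
          diagonal = ℕ.solve-∀
        square u v (no u≢v) (yes uv) = entry (suc (k * k)) k 1 0
          (≡.trans (paths u v (λ w → 𝟙-cong (common? u v w) (local? u v w)
            (λ c → uv , c) proj₂)) (κ≡k uv))
          (𝟙-yes (adj? u v) uv) (𝟙-no (u Fin.≟ v) u≢v) (adjacent (suc (k * k)) k)
          where
          adjacent : ∀ d k → k + 2 ≡ d * 0 + k * 1 + 2
          adjacent = ℕ.solve-∀
        square u v (no u≢v) (no u≁v) = entry (suc (k * k)) 2 0 0
          (two-paths (bijoined u v u≢v u≁v))
          (𝟙-no (adj? u v) u≁v) (𝟙-no (u Fin.≟ v) u≢v) (nonadjacent (suc (k * k)) k)
          where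
          nonadjacent : ∀ d k → 2 ≡ d * 0 + k * 0 + 2
          nonadjacent = ℕ.solve-∀
          two-paths : ∃[ a ] ∃[ b ] (a ≢ b × CommonNbr G u v a × CommonNbr G u v b × Adj a b
            × (∀ w → CommonNbr G u v w → w ≡ a ⊎ w ≡ b)) → sum (λ w → A u w * A w v) ≡ 2
          two-paths (a , b , a≢b , ca , cb , _ , only) = ≡.trans
            (paths u v {λ w → δ w a + δ w b} pointwise)
            (≡.trans (∑-distrib-+ (λ w → δ w a) (λ w → δ w b)) (cong₂ _+_ (sum-δ a) (sum-δ b)))
            where
            pointwise : ∀ w → 𝟙 (common? u v w) ≡ δ w a + δ w b
            pointwise w with w Fin.≟ a | w Fin.≟ b
            ... | yes refl | yes a≡b  = contradiction a≡b a≢b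
            ... | yes refl | no _     = 𝟙-yes (common? u v w) ca
            ... | no _     | yes refl = 𝟙-yes (common? u v w) cb
            ... | no w≢a   | no w≢b   = 𝟙-no (common? u v w) (λ c → [ w≢a , w≢b ]′ (only w c))

theorem2p4 : (n : ℕ) (G : Graph (suc n)) → Condition-i G → Condition-ii G →
    ∃[ x ] Universal G x
theorem2p4 n G bijoined K₄-free = decidable-stable
  (any? λ x → all? λ y → ¬? (y Fin.≟ x) →-dec Graph.adj? G x y)
  λ ∄universal →
    let o = Fin.zero
        x , ox = has-neighbour ∄universal o
        κ≡k = λ {v} {y} vy → κ-constant ∄universal {v} {y} vy ox
    in moore-degree-impossible (moore-degree (local-moore ∄universal κ≡k o) (2≤κ ∄universal ox))
         (sum-1 (suc n)) (strongly-regular ∄universal κ≡k o)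
  where open BijoinedGraph G bijoined K₄-free
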